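{- Let $k\geq 2$ be an integer and $f_k(x)=x^{2k+1}+2x+1$. Then for all $a,b\in\mathbb{Z}$ with $a\neq 0$, the polynomial $f_k(ax^2+b)$ is irreducible over $\mathbb{Z}$. -}

module Defs where

open import Data.Nat as ℕ using (ℕ; zero; suc)
open import Data.Integer using (ℤ; _+_; _*_; 0ℤ; 1ℤ)
open import Data.List using (List; []; _∷_; map; replicate; _++_)
open import Data.Product using (∃; _×_; Σ)
open import Data.Empty using (⊥)
open import Relation.Binary.PropositionalEquality using (_≡_; _≢_)

-- Polynomials over ℤ as coefficient lists, lowest degree first:
-- c₀ ∷ c₁ ∷ … ∷ cₙ ∷ []  represents  c₀ + c₁ x + … + cₙ xⁿ.
-- Trailing zeros are allowed; equality is coefficientwise (_≈P_).
Poly : Set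
Poly = List ℤ

coeff : Poly → ℕ → ℤ
coeff []       _       = 0ℤ
coeff (c ∷ _)  zero    = c
coeff (_ ∷ cs) (suc n) = coeff cs n

_≈P_ : Poly → Poly → Set
p ≈P q = ∀ n → coeff p n ≡ coeff q n

infixl 6 _+P_
infixl 7 _*P_

_+P_ : Poly → Poly → Poly
[]       +P q        = q
(c ∷ cs) +P []       = c ∷ cs
(c ∷ cs) +P (d ∷ ds) = (c + d) ∷ (cs +P ds)

_*P_ : Poly → Poly → Poly
[]       *P q = []
(c ∷ cs) *P q = map (c *_) q +P (0ℤ ∷ (cs *P q))

_∘P_ : Poly → Poly → Poly
[]       ∘P q = []
(c ∷ cs) ∘P q = (c ∷ []) +P (q *P (cs ∘P q))

NonConstant : Poly → Set
NonConstant p = ∃ λ n → coeff p (suc n) ≢ 0ℤ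

-- Irreducible over ℤ in the sense of the paper: F is not a product of two
-- integer polynomials of positive degree.  (F itself is nonconstant.)
IrreducibleOverℤ : Poly → Set
IrreducibleOverℤ F =
  NonConstant F ×
  (∀ g h → NonConstant g → NonConstant h → (g *P h) ≈P F → ⊥)

-- f_k(x) = x^(2k+1) + 2x + 1   (for k ≥ 1; list  1, 2, 0, …, 0, 1)
f : ℕ → Poly
f k = 1ℤ ∷ Data.Integer.+ 2 ∷ (replicate (2 ℕ.* k ℕ.∸ 1) 0ℤ ++ (1ℤ ∷ []))

quadAB : ℤ → ℤ → Poly
quadAB a b = b ∷ 0ℤ ∷ a ∷ []

{-# OPTIONS --safe #-}

-- Write n = 2k + 1, F = x^n + 2x + 1 and u = a x² + b.
--
-- F is irreducible by Ljunggren's method. If F = g h, then q = g · rev h satisfies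
-- q · rev q = F · rev F, where rev reverses the coefficients. The middle coefficient says that the
-- squares of the coefficients of q sum to 6, and with the outer coefficients this leaves only
-- q = ±F and q = ±rev F. Hence a factor of F divides rev F too; but the ideal (F, rev F) contains 8.
--
-- If g h = F(u), write, up to nonzero constants, g = B(u) + x A(u) and h = B′(u) + x A′(u), and put
-- M = a B² − (z − b) A², which is g(x) g(−x) up to a constant, with z = u; M′ likewise. Then M M′ is a
-- constant multiple of F², and since F is prime over ℚ and neither M nor M′ is constant,
-- m F = c (a B² − (z − b) A²) with integers m ≠ 0 and c.
--
-- No identity m F = a B² + c (z − b) A² with m ≠ 0 exists: if m is even, each of the two terms on the
-- right can be halved, so take m odd. Unless a and c are odd, the coefficients 0, 1 or n give a
-- contradiction modulo 2. If they are odd, the coefficients 1, 3 and 2 show that A₀, A₁ and B₁ are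
-- even, and then the coefficient of z on the right is divisible by 4, while on the left it is 2m.
-- This uses that F has no cubic term, i.e. k ≥ 2.
module Submission where

open import Defs
open import Data.Nat using (ℕ; _≤_)
open import Data.Integer using (ℤ; 0ℤ)
open import Relation.Binary.PropositionalEquality using (_≢_)

open import Algebra.Bundles using (CommutativeRing)
open import Algebra.Solver.Ring.AlmostCommutativeRing using (_-Raw-AlmostCommutative⟶_; fromCommutativeRing)
import Algebra.Solver.Ring
import Relation.Binary.Reasoning.Setoid
open import Data.Empty using (⊥; ⊥-elim)
open import Data.Integer using (+_; -[1+_]; 1ℤ; -1ℤ; -_; _+_; _*_; _-_; ∣_∣)
open import Data.Integer.Divisibility.Signed using (_∣_; divides; ∣ᵤ⇒∣; ∣⇒∣ᵤ; ∣m⇒∣m*n; ∣n⇒∣m*n; ∣m+n∣m⇒∣n; ∣m+n∣n⇒∣m; ∣m∣n⇒∣m+n; _∣?_)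
import Data.Integer.Properties as ℤ
open import Data.Integer.Tactic.RingSolver using (solve-∀)
open import Data.List using ([]; _∷_; map; replicate; _++_)
open import Data.List.Relation.Unary.All using (All; []; _∷_)
open import Data.Maybe using (Maybe; just; nothing)
open import Data.Nat as ℕ using (zero; suc; z≤n; s≤s)
open import Data.Nat.ListAction using (product)
open import Data.Nat.Primality using (Prime; euclidsLemma; prime⇒nonZero; prime[2])
open import Data.Nat.Primality.Factorisation using (factorise; module PrimeFactorisation)
import Data.Nat.Divisibility as ℕ∣
import Data.Nat.Properties as ℕ
open import Data.Product using (∃; ∃₂; _×_; _,_; proj₁; proj₂)
open import Data.Sum as Sum using (_⊎_; inj₁; inj₂)
open import Function using (_∘_)
open import Level using (0ℓ)
open import Relation.Binary.PropositionalEquality using (_≡_; refl; sym; trans; cong; cong₂; subst; module ≡-Reasoning)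
open import Relation.Nullary using (¬_; Dec; yes; no)

-- Convolution of coefficient sequences

Seq : Set
Seq = ℕ → ℤ

-- The Cauchy product. Infinite sequences do not see trailing zeros or list lengths, so the ring
-- laws of polynomials are proved here and transferred by `coeff-*P`.
conv : Seq → Seq → Seq
conv s t zero    = s 0 * t 0
conv s t (suc n) = s 0 * t (suc n) + conv (s ∘ suc) t n

conv-cong : ∀ {s s′ t t′ : Seq} → (∀ i → s i ≡ s′ i) → (∀ i → t i ≡ t′ i) → ∀ n → conv s t n ≡ conv s′ t′ n
conv-cong p q zero    = cong₂ _*_ (p 0) (q 0)
conv-cong p q (suc n) = cong₂ _+_ (cong₂ _*_ (p 0) (q (suc n))) (conv-cong (p ∘ suc) q n)

conv-zeroˡ : ∀ {s} t → (∀ i → s i ≡ 0ℤ) → ∀ n → conv s t n ≡ 0ℤ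
conv-zeroˡ t s≡0 zero    rewrite s≡0 0 = refl
conv-zeroˡ t s≡0 (suc n) rewrite s≡0 0 | conv-zeroˡ t (s≡0 ∘ suc) n = refl

conv-distribʳ : ∀ s s′ t n → conv (λ i → s i + s′ i) t n ≡ conv s t n + conv s′ t n
conv-distribʳ s s′ t zero    = ℤ.*-distribʳ-+ (t 0) (s 0) (s′ 0)
conv-distribʳ s s′ t (suc n) rewrite conv-distribʳ (s ∘ suc) (s′ ∘ suc) t n =
  shuffle (s 0) (s′ 0) (t (suc n)) (conv (s ∘ suc) t n) (conv (s′ ∘ suc) t n)
  where
  shuffle : ∀ a a′ b x y → (a + a′) * b + (x + y) ≡ a * b + x + (a′ * b + y)
  shuffle = solve-∀

conv-scaleˡ : ∀ c s t n → conv (λ i → c * s i) t n ≡ c * conv s t n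
conv-scaleˡ c s t zero    = ℤ.*-assoc c (s 0) (t 0)
conv-scaleˡ c s t (suc n) rewrite conv-scaleˡ c (s ∘ suc) t n = shuffle c (s 0) (t (suc n)) (conv (s ∘ suc) t n)
  where
  shuffle : ∀ c a b x → c * a * b + c * x ≡ c * (a * b + x)
  shuffle = solve-∀

-- The definition peels off the first term of the sum. Peeling off the last one gives commutativity,
-- and later pairs the two outer terms of a square.
conv-sucʳ : ∀ s t n → conv s t (suc n) ≡ conv s (t ∘ suc) n + s (suc n) * t 0
conv-sucʳ s t zero    = refl
conv-sucʳ s t (suc n) rewrite conv-sucʳ (s ∘ suc) t n = sym (ℤ.+-assoc (s 0 * t (2 ℕ.+ n)) _ _)

conv-comm : ∀ s t n → conv s t n ≡ conv t s n
conv-comm s t zero    = ℤ.*-comm (s 0) (t 0)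
conv-comm s t (suc n) rewrite conv-sucʳ t s n | conv-comm (s ∘ suc) t n = shuffle (s 0) (t (suc n)) (conv t (s ∘ suc) n)
  where
  shuffle : ∀ a b x → a * b + x ≡ x + b * a
  shuffle = solve-∀

conv-assoc : ∀ s t r n → conv (conv s t) r n ≡ conv s (conv t r) n
conv-assoc s t r zero    = ℤ.*-assoc (s 0) (t 0) (r 0)
conv-assoc s t r (suc n)
  -- The shift of `conv s t` is by definition `s 0` times the shifted `t` plus `conv (s ∘ suc) t`;
  -- the two parts are convolved with `r` separately.
  rewrite conv-distribʳ (λ i → s 0 * t (suc i)) (conv (s ∘ suc) t) r n
        | conv-scaleˡ (s 0) (t ∘ suc) r n
        | conv-assoc (s ∘ suc) t r n
  = shuffle (s 0) (t 0) (r (suc n)) (conv (t ∘ suc) r n) (conv (s ∘ suc) (conv t r) n)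
  where
  shuffle : ∀ a b c x y → a * b * c + (a * x + y) ≡ a * (b * c + x) + y
  shuffle = solve-∀

-- The ring ℤ[x]

coeff-+P : ∀ p q n → coeff (p +P q) n ≡ coeff p n + coeff q n
coeff-+P []      q       n       = sym (ℤ.+-identityˡ (coeff q n))
coeff-+P (c ∷ p) []      n       = sym (ℤ.+-identityʳ (coeff (c ∷ p) n))
coeff-+P (c ∷ p) (d ∷ q) zero    = refl
coeff-+P (c ∷ p) (d ∷ q) (suc n) = coeff-+P p q n

coeff-scale : ∀ c p n → coeff (map (c *_) p) n ≡ c * coeff p n
coeff-scale c []      n       = sym (ℤ.*-zeroʳ c)
coeff-scale c (d ∷ p) zero    = refl
coeff-scale c (d ∷ p) (suc n) = coeff-scale c p n

coeff-*P : ∀ p q n → coeff (p *P q) n ≡ conv (coeff p) (coeff q) n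
coeff-*P []      q n       = sym (conv-zeroˡ (coeff q) (λ _ → refl) n)
coeff-*P (c ∷ p) q zero    = trans (coeff-+P (map (c *_) q) _ 0)
  (trans (ℤ.+-identityʳ _) (coeff-scale c q 0))
coeff-*P (c ∷ p) q (suc n) = trans (coeff-+P (map (c *_) q) _ (suc n))
  (cong₂ _+_ (coeff-scale c q (suc n)) (coeff-*P p q n))

-- A wrapper of _≈P_ from which Agda can infer both polynomials.
infix 4 _≋_
record _≋_ (p q : Poly) : Set where
  constructor mk≋
  field at : p ≈P q
open _≋_

-P_ : Poly → Poly
-P p = map -_ p

C : ℤ → Poly
C c = c ∷ []

X : Poly
X = 0ℤ ∷ 1ℤ ∷ []

coeff--P : ∀ p n → coeff (-P p) n ≡ - coeff p n
coeff--P []      n       = refl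
coeff--P (c ∷ p) zero    = refl
coeff--P (c ∷ p) (suc n) = coeff--P p n

coeff-C* : ∀ c p n → coeff (C c *P p) n ≡ c * coeff p n
coeff-C* c p n = trans (coeff-*P (C c) p n) (conv-C n)
  where
  conv-C : ∀ n → conv (coeff (C c)) (coeff p) n ≡ c * coeff p n
  conv-C zero    = refl
  conv-C (suc n) rewrite conv-zeroˡ {λ _ → 0ℤ} (coeff p) (λ _ → refl) n = ℤ.+-identityʳ _

*P-via : ∀ {p q r s n} → conv (coeff p) (coeff q) n ≡ conv (coeff r) (coeff s) n → coeff (p *P q) n ≡ coeff (r *P s) n
*P-via {p} {q} {r} {s} {n} e = trans (coeff-*P p q n) (trans e (sym (coeff-*P r s n)))

polyRing : CommutativeRing 0ℓ 0ℓ
polyRing = record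
  { Carrier = Poly ; _≈_ = _≋_ ; _+_ = _+P_ ; _*_ = _*P_ ; -_ = -P_ ; 0# = [] ; 1# = C 1ℤ
  ; isCommutativeRing = record
    { isRing = record
      { +-isAbelianGroup = record
        { isGroup = record
          { isMonoid = record
            { isSemigroup = record
              { isMagma = record
                { isEquivalence = record
                  { refl  = mk≋ λ n → refl
                  ; sym   = λ e → mk≋ λ n → sym (at e n)
                  ; trans = λ e e′ → mk≋ λ n → trans (at e n) (at e′ n) }
                ; ∙-cong = λ {p} {q} {r} {s} e e′ → mk≋ λ n → trans (coeff-+P p r n)
                    (trans (cong₂ _+_ (at e n) (at e′ n)) (sym (coeff-+P q s n))) }
              ; assoc = λ p q r → mk≋ λ n → +P-assoc p q r n }
            ; identity = (λ p → mk≋ λ n → refl) , (λ p → mk≋ λ n → trans (coeff-+P p [] n) (ℤ.+-identityʳ _)) }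
          ; inverse = (λ p → mk≋ λ n → trans (+P-comm (-P p) p n) (inverseʳ p n)) , (λ p → mk≋ (inverseʳ p))
          ; ⁻¹-cong = λ {p} {q} e → mk≋ λ n → trans (coeff--P p n) (trans (cong -_ (at e n)) (sym (coeff--P q n))) }
        ; comm = λ p q → mk≋ (+P-comm p q) }
      ; *-cong = λ {p} {q} {r} {s} e e′ → mk≋ λ n → *P-via {p} {r} {q} {s} {n} (conv-cong (at e) (at e′) n)
      ; *-assoc = λ p q r → mk≋ λ n → *P-via {p *P q} {r} {p} {q *P r} {n} (trans
          (conv-cong (coeff-*P p q) (λ _ → refl) n) (trans (conv-assoc (coeff p) (coeff q) (coeff r) n)
          (conv-cong {coeff p} (λ _ → refl) (λ i → sym (coeff-*P q r i)) n)))
      ; *-identity = (λ p → mk≋ (identityˡ p)) , (λ p → mk≋ λ n → trans (*P-comm p (C 1ℤ) n) (identityˡ p n))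
      ; distrib = (λ p q r → mk≋ λ n → trans (*P-comm p (q +P r) n) (trans (distribʳ p q r n)
          (trans (coeff-+P (q *P p) (r *P p) n) (trans (cong₂ _+_ (*P-comm q p n) (*P-comm r p n))
          (sym (coeff-+P (p *P q) (p *P r) n)))))) , (λ p q r → mk≋ (distribʳ p q r)) }
    ; *-comm = λ p q → mk≋ (*P-comm p q) } }
  where
  +P-comm : ∀ p q → (p +P q) ≈P (q +P p)
  +P-comm p q n rewrite coeff-+P p q n | coeff-+P q p n = ℤ.+-comm (coeff p n) (coeff q n)
  +P-assoc : ∀ p q r → ((p +P q) +P r) ≈P (p +P (q +P r))
  +P-assoc p q r n
    rewrite coeff-+P (p +P q) r n | coeff-+P p q n | coeff-+P p (q +P r) n | coeff-+P q r n = ℤ.+-assoc (coeff p n) _ _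
  inverseʳ : ∀ p → (p +P (-P p)) ≈P []
  inverseʳ p n rewrite coeff-+P p (-P p) n | coeff--P p n = ℤ.+-inverseʳ (coeff p n)
  *P-comm : ∀ p q → (p *P q) ≈P (q *P p)
  *P-comm p q n = *P-via {p} {q} {q} {p} (conv-comm (coeff p) (coeff q) n)
  identityˡ : ∀ p → (C 1ℤ *P p) ≈P p
  identityˡ p n = trans (coeff-C* 1ℤ p n) (ℤ.*-identityˡ _)
  distribʳ : ∀ p q r → ((q +P r) *P p) ≈P ((q *P p) +P (r *P p))
  distribʳ p q r n
    rewrite coeff-+P (q *P p) (r *P p) n | coeff-*P (q +P r) p n | coeff-*P q p n | coeff-*P r p n
    = trans (conv-cong (coeff-+P q r) (λ _ → refl) n) (conv-distribʳ (coeff q) (coeff r) (coeff p) n)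

module P = CommutativeRing polyRing
module ≋-Reasoning = Relation.Binary.Reasoning.Setoid P.setoid

+P-congˡ : ∀ p {q r} → q ≋ r → p +P q ≋ p +P r
+P-congˡ p e = P.+-cong (P.refl {p}) e

+P-congʳ : ∀ p {q r} → q ≋ r → q +P p ≋ r +P p
+P-congʳ p e = P.+-cong e (P.refl {p})

*P-congˡ : ∀ p {q r} → q ≋ r → p *P q ≋ p *P r
*P-congˡ p e = P.*-cong (P.refl {p}) e

*P-congʳ : ∀ p {q r} → q ≋ r → q *P p ≋ r *P p
*P-congʳ p e = P.*-cong e (P.refl {p})

C-+ : ∀ c d → C (c + d) ≋ C c +P C d
C-+ c d = P.refl

C-* : ∀ c d → C (c * d) ≋ C c *P C d
C-* c d = mk≋ λ { zero → sym (ℤ.+-identityʳ (c * d)) ; (suc n) → refl }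

C-≟ : ∀ c d → Maybe (C c ≋ C d)
C-≟ c d with c ℤ.≟ d
... | yes refl = just P.refl
... | no _     = nothing

-- The ring solver takes its numerals from ℤ through constant polynomials, so that identities with
-- coefficients such as 2 or 8 are decided by computing in ℤ.
C-homo : CommutativeRing.rawRing ℤ.+-*-commutativeRing -Raw-AlmostCommutative⟶ fromCommutativeRing polyRing
C-homo = record
  { ⟦_⟧ = C ; +-homo = C-+ ; *-homo = C-* ; -‿homo = λ _ → P.refl
  ; 0-homo = mk≋ λ { zero → refl ; (suc n) → refl } ; 1-homo = P.refl }

open Algebra.Solver.Ring _ _ C-homo C-≟ using (solve; _:=_; _:+_; _:*_; _:-_; :-_; con)

-- Degrees

-- A strict bound on the degree, satisfied by the zero polynomial for every `d`; the list may be
-- longer than the bound.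
Below : Poly → ℕ → Set
Below p d = ∀ i → d ≤ i → coeff p i ≡ 0ℤ

record Deg (p : Poly) (d : ℕ) : Set where
  constructor deg
  field
    lead  : coeff p d ≢ 0ℤ
    below : Below p (suc d)
open Deg

conv-constˡ : ∀ {s} t → (∀ i → 1 ≤ i → s i ≡ 0ℤ) → ∀ n → conv s t n ≡ s 0 * t n
conv-constˡ t s≡0 zero = refl
conv-constˡ {s} t s≡0 (suc n) rewrite conv-zeroˡ t (λ i → s≡0 (suc i) (s≤s z≤n)) n = ℤ.+-identityʳ _

conv-above : ∀ d e {s t : Seq} → (∀ i → suc d ≤ i → s i ≡ 0ℤ) → (∀ i → suc e ≤ i → t i ≡ 0ℤ) →
  ∀ i → suc (d ℕ.+ e) ≤ i → conv s t i ≡ 0ℤ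
conv-above zero    e {s} {t} p q i       e<i rewrite conv-constˡ t p i | q i e<i = ℤ.*-zeroʳ (s 0)
conv-above (suc d) e {s} {t} p q (suc i) (s≤s d+e<i)
  rewrite q (suc i) (s≤s (ℕ.≤-trans (ℕ.m≤n+m e (suc d)) (ℕ.≤-trans d+e<i ℕ.≤-refl)))
        | conv-above d e {s ∘ suc} {t} (λ j d<j → p (suc j) (s≤s d<j)) q i d+e<i
  = trans (ℤ.+-identityʳ _) (ℤ.*-zeroʳ (s 0))

conv-top : ∀ d e {s t : Seq} → (∀ i → suc d ≤ i → s i ≡ 0ℤ) → (∀ i → suc e ≤ i → t i ≡ 0ℤ) →
  conv s t (d ℕ.+ e) ≡ s d * t e
conv-top zero    e {s} {t} p q = conv-constˡ t p e
conv-top (suc d) e {s} {t} p q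
  rewrite q (suc (d ℕ.+ e)) (s≤s (ℕ.m≤n+m e d))
        | conv-top d e {s ∘ suc} {t} (λ j d<j → p (suc j) (s≤s d<j)) q
        | ℤ.*-zeroʳ (s 0) = ℤ.+-identityˡ _

Below-* : ∀ {p q} d e → Below p (suc d) → Below q (suc e) → Below (p *P q) (suc (d ℕ.+ e))
Below-* {p} {q} d e P Q i d+e<i = trans (coeff-*P p q i) (conv-above d e P Q i d+e<i)

coeff-top : ∀ {p q} d e → Below p (suc d) → Below q (suc e) → coeff (p *P q) (d ℕ.+ e) ≡ coeff p d * coeff q e
coeff-top {p} {q} d e P Q = trans (coeff-*P p q (d ℕ.+ e)) (conv-top d e P Q)

m*n≢0 : ∀ {m n : ℤ} → m ≢ 0ℤ → n ≢ 0ℤ → m * n ≢ 0ℤ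
m*n≢0 {m} m≢0 n≢0 mn≡0 with ℤ.i*j≡0⇒i≡0∨j≡0 m mn≡0
... | inj₁ m≡0 = m≢0 m≡0
... | inj₂ n≡0 = n≢0 n≡0

Deg-* : ∀ {p q d e} → Deg p d → Deg q e → Deg (p *P q) (d ℕ.+ e)
Deg-* {p} {q} {d} {e} (deg p≢0 P) (deg q≢0 Q) =
  deg (λ pq≡0 → m*n≢0 p≢0 q≢0 (trans (sym (coeff-top {p} {q} d e P Q)) pq≡0)) (Below-* {p} {q} d e P Q)

Deg-cong : ∀ {p q d} → p ≋ q → Deg p d → Deg q d
Deg-cong e (deg p≢0 P) = deg (λ q≡0 → p≢0 (trans (at e _) q≡0)) λ i d<i → trans (sym (at e i)) (P i d<i)

Deg-< : ∀ {p d e} → Deg p d → Below p e → suc d ≤ e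
Deg-< {p} {d} {e} (deg p≢0 _) P with suc d ℕ.≤? e
... | yes d<e = d<e
... | no  d≮e = ⊥-elim (p≢0 (P d (ℕ.≮⇒≥ d≮e)))

Deg-unique : ∀ {p d e} → Deg p d → Deg p e → d ≡ e
Deg-unique D E = ℕ.≤-antisym (ℕ.≤-pred (Deg-< D (below E))) (ℕ.≤-pred (Deg-< E (below D)))

¬Deg[] : ∀ {p d} → p ≋ [] → ¬ Deg p d
¬Deg[] e (deg p≢0 _) = p≢0 (at e _)

C-deg : ∀ {c} → c ≢ 0ℤ → Deg (C c) 0
C-deg c≢0 = deg c≢0 λ { (suc i) _ → refl }

∷-deg : ∀ {c p d} → Deg p d → Deg (c ∷ p) (suc d)
∷-deg (deg p≢0 P) = deg p≢0 λ { (suc i) (s≤s d<i) → P i d<i }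

-- A list ending in zeros is too long to show the degree, so the last nonzero coefficient is
-- searched for, by decidable equality in ℤ.
zero-or-degree : ∀ p → p ≋ [] ⊎ ∃ (Deg p)
zero-or-degree []      = inj₁ P.refl
zero-or-degree (c ∷ p) with zero-or-degree p
... | inj₂ (d , D) = inj₂ (suc d , ∷-deg D)
... | inj₁ p≋[] with c ℤ.≟ 0ℤ
...   | yes c≡0 = inj₁ (mk≋ λ { zero → c≡0 ; (suc n) → at p≋[] n })
...   | no  c≢0 = inj₂ (0 , deg c≢0 λ { (suc i) _ → at p≋[] i })

Deg⇒NonConstant : ∀ {p d} → Deg p (suc d) → NonConstant p
Deg⇒NonConstant (deg p≢0 _) = _ , p≢0

NonConstant⇒Deg : ∀ p → NonConstant p → ∃ λ d → Deg p (suc d)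
NonConstant⇒Deg p (n , pₙ≢0) with zero-or-degree p
... | inj₁ p≋[]          = ⊥-elim (pₙ≢0 (at p≋[] (suc n)))
... | inj₂ (zero  , D)   = ⊥-elim (pₙ≢0 (below D (suc n) (s≤s z≤n)))
... | inj₂ (suc d , D)   = d , D

NonConstant-C* : ∀ c {p q} → C c *P p ≋ q → NonConstant q → NonConstant p
NonConstant-C* c {p} e (n , q≢0) = n , λ p≡0 →
  q≢0 (trans (sym (at e (suc n))) (trans (coeff-C* c p (suc n)) (trans (cong (c *_) p≡0) (ℤ.*-zeroʳ c))))

Deg0⇒const : ∀ {p} → Deg p 0 → ∃ λ c → c ≢ 0ℤ × p ≋ C c
Deg0⇒const {p} (deg p≢0 P) = coeff p 0 , p≢0 , mk≋ λ { zero → refl ; (suc n) → P (suc n) (s≤s z≤n) }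

-- Neither factor is zero and degrees add up, so both degrees are 0.
const-factors : ∀ {p q c} → c ≢ 0ℤ → p *P q ≋ C c → Deg p 0 × Deg q 0
const-factors {p} {q} c≢0 e with zero-or-degree p | zero-or-degree q
... | inj₁ p≋[] | _ = ⊥-elim (¬Deg[] (P.trans (P.sym e) (P.trans (P.*-cong p≋[] P.refl) P.refl)) (C-deg c≢0))
... | inj₂ _ | inj₁ q≋[] =
  ⊥-elim (¬Deg[] (P.trans (P.sym e) (P.trans (P.*-cong (P.refl {p}) q≋[]) (P.zeroʳ p))) (C-deg c≢0))
... | inj₂ (zero , D) | inj₂ (zero , D′) = D , D′
... | inj₂ (zero , D) | inj₂ (suc _ , D′) with Deg-unique (Deg-cong e (Deg-* D D′)) (C-deg c≢0)
...   | ()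
const-factors {p} {q} c≢0 e | inj₂ (suc _ , D) | inj₂ (_ , D′) with Deg-unique (Deg-cong e (Deg-* D D′)) (C-deg c≢0)
...   | ()

∤const : ∀ {p q c} → c ≢ 0ℤ → NonConstant p → ¬ (p *P q ≋ C c)
∤const {p} c≢0 N e with NonConstant⇒Deg p N
... | d , D with Deg-unique D (proj₁ (const-factors {p} c≢0 e))
... | ()

-- The product of `p` and `q - r` is zero; if `q - r` had a degree, so would this product.
*P-cancelˡ : ∀ {p q r d} → Deg p d → p *P q ≋ p *P r → q ≋ r
*P-cancelˡ {p} {q} {r} D e with zero-or-degree (q +P -P r)
... | inj₁ q-r≋0 = begin
  q                  ≈⟨ solve 2 (λ q r → q := (q :- r) :+ r) P.refl q r ⟩
  (q +P -P r) +P r   ≈⟨ P.+-cong q-r≋0 P.refl ⟩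
  r                  ∎
  where open ≋-Reasoning
... | inj₂ (_ , D′) = ⊥-elim (¬Deg[] vanish (Deg-* D D′))
  where
  open ≋-Reasoning
  vanish : p *P (q +P -P r) ≋ []
  vanish = begin
    p *P (q +P -P r)         ≈⟨ solve 3 (λ p q r → p :* (q :- r) := p :* q :- p :* r) P.refl p q r ⟩
    p *P q +P -P (p *P r)    ≈⟨ P.+-cong e P.refl ⟩
    p *P r +P -P (p *P r)    ≈⟨ P.-‿inverseʳ (p *P r) ⟩
    []                       ∎

-- Reversal

shift : ℕ → Poly → Poly
shift n p = replicate n 0ℤ ++ p

coeff-shift : ∀ n p i → coeff (shift n p) (n ℕ.+ i) ≡ coeff p i
coeff-shift zero    p i = refl
coeff-shift (suc n) p i = coeff-shift n p i

coeff-shift-< : ∀ n p i → suc i ≤ n → coeff (shift n p) i ≡ 0ℤ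
coeff-shift-< (suc n) p zero    _         = refl
coeff-shift-< (suc n) p (suc i) (s≤s i<n) = coeff-shift-< n p i i<n

shift-below : ∀ n p {d} → Below p d → Below (shift n p) (n ℕ.+ d)
shift-below zero    p P i       d≤i       = P i d≤i
shift-below (suc n) p P (suc i) (s≤s d≤i) = shift-below n p P i d≤i

∷-cong : ∀ {c p q} → p ≋ q → c ∷ p ≋ c ∷ q
∷-cong e = mk≋ λ { zero → refl ; (suc n) → at e n }

C-below : ∀ c → Below (C c) 1
C-below c (suc i) _ = refl

0∷-* : ∀ p q → (0ℤ ∷ p) *P q ≋ 0ℤ ∷ (p *P q)
0∷-* p q = mk≋ λ n → trans (coeff-+P (map (0ℤ *_) q) _ n)
  (trans (cong (_+ coeff (0ℤ ∷ (p *P q)) n) (coeff-scale 0ℤ q n)) (ℤ.+-identityˡ _))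

shift-* : ∀ n p q → shift n p *P q ≋ shift n (p *P q)
shift-* zero    p q = P.refl
shift-* (suc n) p q = P.trans (0∷-* (shift n p) q) (∷-cong (shift-* n p q))

shift-cong : ∀ n {p q} → p ≋ q → shift n p ≋ shift n q
shift-cong zero    e = e
shift-cong (suc n) e = ∷-cong (shift-cong n e)

shift-C : ∀ n c → shift n (C c) ≋ C c *P shift n (C 1ℤ)
shift-C n c = begin
  shift n (C c)             ≈⟨ shift-cong n (P.*-identityˡ (C c)) ⟨
  shift n (C 1ℤ *P C c)     ≈⟨ shift-* n (C 1ℤ) (C c) ⟨
  shift n (C 1ℤ) *P C c     ≈⟨ P.*-comm (shift n (C 1ℤ)) (C c) ⟩
  C c *P shift n (C 1ℤ)     ∎
  where open ≋-Reasoning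

-- For p of degree at most N, rv N p is x^N p(1/x).
rv : ℕ → Poly → Poly
rv N       []      = []
rv zero    (c ∷ p) = C c
rv (suc N) (c ∷ p) = shift (suc N) (C c) +P rv N p

rv-below : ∀ N p → Below (rv N p) (suc N)
rv-below N       []      i       _         = refl
rv-below zero    (c ∷ p) (suc i) _         = refl
rv-below (suc N) (c ∷ p) i       N<i rewrite coeff-+P (shift (suc N) (C c)) (rv N p) i
  | rv-below N p i (ℕ.≤-trans (ℕ.n≤1+n (suc N)) N<i)
  | shift-below (suc N) (C c) (C-below c) i (subst (_≤ i) (ℕ.+-comm 1 (suc N)) N<i) = refl

coeff-rv : ∀ N p i j → i ℕ.+ j ≡ N → coeff (rv N p) i ≡ coeff p j
coeff-rv N       []      i       j       _ = refl
coeff-rv zero    (c ∷ p) zero    zero    _ = refl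
coeff-rv (suc N) (c ∷ p) i       zero    e
  rewrite ℕ.+-identityʳ i | e | coeff-+P (shift (suc N) (C c)) (rv N p) (suc N) | rv-below N p (suc N) ℕ.≤-refl
  = trans (ℤ.+-identityʳ _) (trans (cong (coeff (shift N (C c))) (sym (ℕ.+-identityʳ N))) (coeff-shift N (C c) 0))
coeff-rv (suc N) (c ∷ p) i       (suc j) e
  rewrite coeff-+P (shift (suc N) (C c)) (rv N p) i
        | coeff-shift-< (suc N) (C c) i (subst (suc i ≤_) e (ℕ.m<m+n i (s≤s z≤n)))
  = trans (ℤ.+-identityˡ _) (coeff-rv N p i j (ℕ.suc-injective (trans (sym (ℕ.+-suc i j)) e)))

-- Coefficients determine the reverse, which lets most laws below be checked index by index instead
-- of along the recursion of `rv`.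
rv-unique : ∀ N p {q} → Below q (suc N) → (∀ i j → i ℕ.+ j ≡ N → coeff q i ≡ coeff p j) → q ≋ rv N p
rv-unique N p {q} Q h = mk≋ coeffs
  where
  coeffs : q ≈P rv N p
  coeffs i with i ℕ.≤? N
  ... | yes i≤N = trans (h i (N ℕ.∸ i) (ℕ.m+[n∸m]≡n i≤N)) (sym (coeff-rv N p i _ (ℕ.m+[n∸m]≡n i≤N)))
  ... | no  i≰N = trans (Q i (ℕ.≰⇒> i≰N)) (sym (rv-below N p i (ℕ.≰⇒> i≰N)))

rv-cong : ∀ N {p q} → p ≋ q → rv N p ≋ rv N q
rv-cong N {p} {q} e = rv-unique N q (rv-below N p) λ i j i+j≡N → trans (coeff-rv N p i j i+j≡N) (at e j)

rv-+ : ∀ N p q → rv N (p +P q) ≋ rv N p +P rv N q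
rv-+ N p q = P.sym (rv-unique N (p +P q)
  (λ i N<i → trans (coeff-+P (rv N p) _ i) (cong₂ _+_ (rv-below N p i N<i) (rv-below N q i N<i)))
  (λ i j e → trans (coeff-+P (rv N p) _ i)
    (trans (cong₂ _+_ (coeff-rv N p i j e) (coeff-rv N q i j e)) (sym (coeff-+P p q j)))))

rv-C* : ∀ N c p → rv N (C c *P p) ≋ C c *P rv N p
rv-C* N c p = P.sym (rv-unique N (C c *P p)
  (λ i N<i → trans (coeff-C* c (rv N p) i) (trans (cong (c *_) (rv-below N p i N<i)) (ℤ.*-zeroʳ c)))
  (λ i j e → trans (coeff-C* c (rv N p) i) (trans (cong (c *_) (coeff-rv N p i j e)) (sym (coeff-C* c p j)))))

rv-0∷ : ∀ N p → rv (suc N) (0ℤ ∷ p) ≋ rv N p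
rv-0∷ N p = P.sym (rv-unique (suc N) (0ℤ ∷ p) (λ i N<i → rv-below N p i (ℕ.≤-trans (ℕ.n≤1+n _) N<i)) coeffs)
  where
  coeffs : ∀ i j → i ℕ.+ j ≡ suc N → coeff (rv N p) i ≡ coeff (0ℤ ∷ p) j
  coeffs i zero    e = rv-below N p i (ℕ.≤-reflexive (trans (sym e) (ℕ.+-identityʳ i)))
  coeffs i (suc j) e = coeff-rv N p i j (ℕ.suc-injective (trans (sym (ℕ.+-suc i j)) e))

-- Raising the formal degree by `N` adds `N` zero leading coefficients, which reversal turns into
-- the lowest ones.
rv-shift : ∀ N M q → Below q (suc M) → rv (N ℕ.+ M) q ≋ shift N (rv M q)
rv-shift N M q Q = P.sym (rv-unique (N ℕ.+ M) q
  (subst (Below (shift N (rv M q))) (ℕ.+-suc N M) (shift-below N (rv M q) (rv-below M q))) coeffs)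
  where
  coeffs : ∀ i j → i ℕ.+ j ≡ N ℕ.+ M → coeff (shift N (rv M q)) i ≡ coeff q j
  coeffs i j e with suc i ℕ.≤? N
  ... | yes i<N = trans (coeff-shift-< N _ i i<N)
    (sym (Q j (ℕ.+-cancelˡ-< i M j (subst (i ℕ.+ M ℕ.<_) (sym e) (ℕ.+-monoˡ-< M i<N)))))
  ... | no  i≮N = trans (cong (coeff (shift N (rv M q))) (sym i≡)) (trans (coeff-shift N (rv M q) (i ℕ.∸ N))
      (coeff-rv M q _ j (ℕ.+-cancelˡ-≡ N _ _ (trans (sym (ℕ.+-assoc N _ j)) (trans (cong (ℕ._+ j) i≡) e)))))
    where
    i≡ : N ℕ.+ (i ℕ.∸ N) ≡ i
    i≡ = ℕ.m+[n∸m]≡n (ℕ.≮⇒≥ i≮N)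

rv-rv : ∀ N p → Below p (suc N) → rv N (rv N p) ≋ p
rv-rv N p P = P.sym (rv-unique N (rv N p) P λ i j e → sym (coeff-rv N p j i (trans (ℕ.+-comm j i) e)))

∷≋C*+0∷ : ∀ c p q → (c ∷ p) *P q ≋ C c *P q +P (0ℤ ∷ (p *P q))
∷≋C*+0∷ c p q = +P-congʳ (0ℤ ∷ (p *P q)) {map (c *_) q} {C c *P q} (mk≋ λ n → trans (coeff-scale c q n) (sym (coeff-C* c q n)))

-- Both sides are x^(N+M) p(1/x) q(1/x). The induction peels off the constant coefficient `c` of
-- `p`, whose contribution c q reverses to c x^(N+1) times the reverse of `q`.
rv-* : ∀ N M p q → Below p (suc N) → Below q (suc M) → rv (N ℕ.+ M) (p *P q) ≋ rv N p *P rv M q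
rv-* N       M []      q P Q = P.refl
rv-* zero    M (c ∷ p) q P Q = P.trans (rv-cong M (*P-congʳ q const)) (rv-C* M c q)
  where
  const : c ∷ p ≋ C c
  const = mk≋ λ { zero → refl ; (suc n) → P (suc n) (s≤s z≤n) }
rv-* (suc N) M (c ∷ p) q P Q = begin
  rv (suc N ℕ.+ M) ((c ∷ p) *P q)                                ≈⟨ rv-cong _ (∷≋C*+0∷ c p q) ⟩
  rv (suc N ℕ.+ M) (C c *P q +P (0ℤ ∷ (p *P q)))                 ≈⟨ rv-+ _ (C c *P q) (0ℤ ∷ (p *P q)) ⟩
  rv (suc N ℕ.+ M) (C c *P q) +P rv (suc N ℕ.+ M) (0ℤ ∷ (p *P q))
    ≈⟨ P.+-cong (P.trans (rv-C* _ c q) (*P-congˡ (C c) (rv-shift (suc N) M q Q))) (rv-0∷ (N ℕ.+ M) (p *P q)) ⟩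
  C c *P shift (suc N) (rv M q) +P rv (N ℕ.+ M) (p *P q)
    ≈⟨ P.+-cong (P.sym shift-C*) (rv-* N M p q (λ i N<i → P (suc i) (s≤s N<i)) Q) ⟩
  shift (suc N) (C c) *P rv M q +P rv N p *P rv M q              ≈⟨ P.distribʳ (rv M q) (shift (suc N) (C c)) (rv N p) ⟨
  rv (suc N) (c ∷ p) *P rv M q                                   ∎
  where
  open ≋-Reasoning
  shift-C* : shift (suc N) (C c) *P rv M q ≋ C c *P shift (suc N) (rv M q)
  shift-C* = begin
    shift (suc N) (C c) *P rv M q             ≈⟨ *P-congʳ (rv M q) (shift-C (suc N) c) ⟩
    (C c *P shift (suc N) (C 1ℤ)) *P rv M q   ≈⟨ P.*-assoc (C c) (shift (suc N) (C 1ℤ)) (rv M q) ⟩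
    C c *P (shift (suc N) (C 1ℤ) *P rv M q)   ≈⟨ *P-congˡ (C c) (P.trans (shift-* (suc N) (C 1ℤ) (rv M q)) (shift-cong (suc N) (P.*-identityˡ (rv M q)))) ⟩
    C c *P shift (suc N) (rv M q)             ∎

-- Irreducibility of T j = f (2 + j), by Ljunggren's method

-- Each step reduces to two successors, so degrees such as `5 + dbl j` compute and their parity is
-- visible to pattern matching.
dbl : ℕ → ℕ
dbl zero    = zero
dbl (suc n) = suc (suc (dbl n))

T : ℕ → Poly
T j = 1ℤ ∷ + 2 ∷ shift (3 ℕ.+ dbl j) (C 1ℤ)

sq : ℤ → ℕ
sq x = ∣ x ∣ ℕ.* ∣ x ∣

sumsq : Seq → ℕ → ℕ
sumsq s zero    = 0
sumsq s (suc m) = sq (s 0) ℕ.+ sumsq (s ∘ suc) m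

sq-+ : ∀ x → x * x ≡ + sq x
sq-+ (+ n)    = sym (ℤ.pos-* n n)
sq-+ -[1+ n ] = refl

-- In the middle coefficient of a product with the reverse, each coefficient meets itself.
conv-reverse : ∀ n {s t : Seq} → (∀ i j → i ℕ.+ j ≡ n → t j ≡ s i) → conv s t n ≡ + sumsq s (suc n)
conv-reverse zero    {s} h rewrite h 0 0 refl | ℕ.+-identityʳ (sq (s 0)) = sq-+ (s 0)
conv-reverse (suc n) {s} h
  rewrite h 0 (suc n) refl | conv-reverse n {s ∘ suc} (λ i j e → h (suc i) j (cong suc e)) | sq-+ (s 0) = refl

sumsq-last : ∀ s m → sumsq s (suc m) ≡ sq (s m) ℕ.+ sumsq s m
sumsq-last s zero    = refl
sumsq-last s (suc m) rewrite sumsq-last (s ∘ suc) m = begin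
  sq (s 0) ℕ.+ (sq (s (suc m)) ℕ.+ rest) ≡⟨ ℕ.+-assoc (sq (s 0)) _ _ ⟨
  sq (s 0) ℕ.+ sq (s (suc m)) ℕ.+ rest   ≡⟨ cong (ℕ._+ rest) (ℕ.+-comm (sq (s 0)) _) ⟩
  sq (s (suc m)) ℕ.+ sq (s 0) ℕ.+ rest   ≡⟨ ℕ.+-assoc (sq (s (suc m))) _ _ ⟩
  sq (s (suc m)) ℕ.+ (sq (s 0) ℕ.+ rest) ∎
  where
  open ≡-Reasoning
  rest = sumsq (s ∘ suc) m

-- The last coefficient enters as `x`, because it will be known as a low coefficient of the reversed
-- sequence.
sumsq-ends : ∀ s m {x} → x ≡ s (suc m) → sumsq s (2 ℕ.+ m) ≡ sq (s 0) ℕ.+ (sq x ℕ.+ sumsq (s ∘ suc) m)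
sumsq-ends s m refl = cong (sq (s 0) ℕ.+_) (sumsq-last (s ∘ suc) m)

sq≡0 : ∀ x → sq x ≡ 0 → x ≡ 0ℤ
sq≡0 (+ zero) _ = refl

sumsq≡0 : ∀ s m → sumsq s m ≡ 0 → ∀ i → suc i ≤ m → s i ≡ 0ℤ
sumsq≡0 s (suc m) e zero    _         = sq≡0 (s 0) (ℕ.m+n≡0⇒m≡0 _ e)
sumsq≡0 s (suc m) e (suc i) (s≤s i<m) = sumsq≡0 (s ∘ suc) m (ℕ.m+n≡0⇒n≡0 (sq (s 0)) e) i i<m

-- Pairs of integers with given sum and small squares

+-solveʳ : ∀ x y {c} → x + y ≡ c → y ≡ c - x
+-solveʳ x y refl = lemma x y
  where
  lemma : ∀ x y → y ≡ x + y - x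
  lemma = solve-∀

too-big : ∀ b {c} m r → suc c ≤ b ℕ.* b → (b ℕ.+ m) ℕ.* (b ℕ.+ m) ℕ.+ r ≢ c
too-big b m r c<b² e = ℕ.<-irrefl refl (ℕ.≤-trans c<b² (ℕ.≤-trans
  (ℕ.≤-trans (ℕ.*-mono-≤ (ℕ.m≤m+n b m) (ℕ.m≤m+n b m)) (ℕ.m≤m+n _ r)) (ℕ.≤-reflexive e)))

too-big′ : ∀ b {c} l m r → suc c ≤ b ℕ.* b → l ℕ.+ ((b ℕ.+ m) ℕ.* (b ℕ.+ m) ℕ.+ r) ≢ c
too-big′ b l m r c<b² e = too-big b m (l ℕ.+ r) c<b² (trans (rearrange l _ r) e)
  where
  rearrange : ∀ l x r → x ℕ.+ (l ℕ.+ r) ≡ l ℕ.+ (x ℕ.+ r)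
  rearrange l x r = trans (sym (ℕ.+-assoc x l r)) (trans (cong (ℕ._+ r) (ℕ.+-comm x l)) (ℕ.+-assoc l x r))

-- Substituting y = 2 - x leaves only x = 0, 1, 2: otherwise x or y is at least 3, and its square
-- exceeds 4.
pair-sum-2 : ∀ x y r → x + y ≡ + 2 → sq x ℕ.+ (sq y ℕ.+ r) ≡ 4 →
  (x ≡ + 2 × y ≡ 0ℤ × r ≡ 0) ⊎ (x ≡ 0ℤ × y ≡ + 2 × r ≡ 0) ⊎ (x ≡ 1ℤ × y ≡ 1ℤ × r ≡ 2)
pair-sum-2 x y r x+y e with +-solveʳ x y x+y
pair-sum-2 (+ 0) y r _ refl | refl = inj₂ (inj₁ (refl , refl , refl))
pair-sum-2 (+ 1) y r _ refl | refl = inj₂ (inj₂ (refl , refl , refl))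
pair-sum-2 (+ 2) y r _ refl | refl = inj₁ (refl , refl , refl)
pair-sum-2 (+ suc (suc (suc m))) y r _ e | refl = ⊥-elim (too-big 3 m _ (ℕ.≤ᵇ⇒≤ 5 9 _) e)
pair-sum-2 -[1+ m ] y r _ e | refl = ⊥-elim (too-big′ 3 (sq -[1+ m ]) m r (ℕ.≤ᵇ⇒≤ 5 9 _) e)

-- The solutions are (0, -1) and (-1, 0). They are merged into the vanishing of the product, the
-- form in which `correlation₄` takes them.
pair-sum--1 : ∀ x y r → x + y ≡ -[1+ 0 ] → sq x ℕ.+ (sq y ℕ.+ r) ≡ 2 → x * y ≡ 0ℤ × r ≡ 1
pair-sum--1 x y r x+y e with +-solveʳ x y x+y
pair-sum--1 (+ 0) y r _ refl | refl = refl , refl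
pair-sum--1 (+ suc m) y r _ e | refl = ⊥-elim (too-big′ 2 (sq (+ suc m)) m r (ℕ.≤ᵇ⇒≤ 3 4 _) e)
pair-sum--1 -[1+ 0 ] y r _ refl | refl = refl , refl
pair-sum--1 -[1+ suc m ] y r _ e | refl = ⊥-elim (too-big 2 m _ (ℕ.≤ᵇ⇒≤ 3 4 _) e)

pair-sum-1 : ∀ x y r → x + y ≡ 1ℤ → sq x ℕ.+ (sq y ℕ.+ r) ≡ 1 → r ≡ 0
pair-sum-1 x y r x+y e with +-solveʳ x y x+y
pair-sum-1 (+ 0) y r _ refl | refl = refl
pair-sum-1 (+ 1) y r _ refl | refl = refl
pair-sum-1 (+ suc (suc m)) y r _ e | refl = ⊥-elim (too-big 2 m _ (ℕ.≤ᵇ⇒≤ 2 4 _) e)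
pair-sum-1 -[1+ m ] y r _ e | refl = ⊥-elim (too-big′ 2 (sq -[1+ m ]) m r (ℕ.≤ᵇ⇒≤ 2 4 _) e)

-- The reverse of `T j` written out, so that the low coefficients of its product with `T j` compute.
Tʳ : ℕ → Poly
Tʳ j = 1ℤ ∷ shift (3 ℕ.+ dbl j) (+ 2 ∷ 1ℤ ∷ [])

SameUpTo : ℕ → Seq → Seq → Set
SameUpTo n s t = ∀ i → i ≤ n → s i ≡ t i

-- `correlation₁` to `correlation₄` solve the coefficient of x^i in the product of `s` and `t` for
-- the sum of their i-th coefficients, given the earlier ones. The coefficients are variables so
-- that matching on `refl` inserts the known values.
correlation₁ : ∀ {s₀ t₀} s₁ t₁ {c} → s₀ ≡ 1ℤ → t₀ ≡ 1ℤ → s₀ * t₁ + s₁ * t₀ ≡ c → s₁ + t₁ ≡ c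
correlation₁ s₁ t₁ refl refl e = trans (lemma s₁ t₁) e
  where
  lemma : ∀ x y → x + y ≡ 1ℤ * y + x * 1ℤ
  lemma = solve-∀

correlation₂ : ∀ {s₀ t₀ s₁ t₁} s₂ t₂ → s₀ ≡ 1ℤ → t₀ ≡ 1ℤ → s₁ ≡ 1ℤ → t₁ ≡ 1ℤ →
  s₀ * t₂ + (s₁ * t₁ + s₂ * t₀) ≡ 0ℤ → s₂ + t₂ ≡ -[1+ 0 ]
correlation₂ s₂ t₂ refl refl refl refl e = trans (lemma s₂ t₂) (cong (_- 1ℤ) e)
  where
  lemma : ∀ x y → x + y ≡ 1ℤ * y + (1ℤ * 1ℤ + x * 1ℤ) - 1ℤ
  lemma = solve-∀

correlation₃ : ∀ {s₀ t₀ s₁ t₁} s₂ t₂ s₃ t₃ → s₀ ≡ 1ℤ → t₀ ≡ 1ℤ → s₁ ≡ 1ℤ → t₁ ≡ 1ℤ → s₂ + t₂ ≡ -[1+ 0 ] →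
  s₀ * t₃ + (s₁ * t₂ + (s₂ * t₁ + s₃ * t₀)) ≡ 0ℤ → s₃ + t₃ ≡ 1ℤ
correlation₃ s₂ t₂ s₃ t₃ refl refl refl refl e₂ e = trans (lemma s₂ t₂ s₃ t₃) (cong₂ _-_ e e₂)
  where
  lemma : ∀ s₂ t₂ s₃ t₃ → s₃ + t₃ ≡ 1ℤ * t₃ + (1ℤ * t₂ + (s₂ * 1ℤ + s₃ * 1ℤ)) - (s₂ + t₂)
  lemma = solve-∀

correlation₄ : ∀ {s₀ t₀ s₁ t₁} s₂ t₂ s₃ t₃ s₄ t₄ → s₀ ≡ 1ℤ → t₀ ≡ 1ℤ → s₁ ≡ 1ℤ → t₁ ≡ 1ℤ →
  s₂ * t₂ ≡ 0ℤ → s₃ + t₃ ≡ 1ℤ →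
  s₀ * t₄ + (s₁ * t₃ + (s₂ * t₂ + (s₃ * t₁ + s₄ * t₀))) ≡ 0ℤ → s₄ + t₄ ≡ -[1+ 0 ]
correlation₄ s₂ t₂ s₃ t₃ s₄ t₄ refl refl refl refl e₂ e₃ e =
  trans (lemma (s₂ * t₂) s₃ t₃ s₄ t₄) (cong₂ _-_ (cong₂ _-_ e e₂) e₃)
  where
  lemma : ∀ x s₃ t₃ s₄ t₄ → s₄ + t₄ ≡ 1ℤ * t₄ + (1ℤ * t₃ + (x + (s₃ * 1ℤ + s₄ * 1ℤ))) - x - (s₃ + t₃)
  lemma = solve-∀

-- The autocorrelation determines s up to reversal: peeling off coefficients from both ends, either
-- the remaining squares sum to 0, or s₁ = t₁ = 1 and the vanishing correlations require squares
-- beyond the total of 6 (symmetric-impossible).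
module Autocorrelation (j : ℕ) (s t : Seq)
  (rev : ∀ i i′ → i ℕ.+ i′ ≡ 5 ℕ.+ dbl j → t i ≡ s i′)
  (correlation : ∀ i → conv s t i ≡ conv (coeff (T j)) (coeff (Tʳ j)) i)
  (norm : sumsq s (6 ℕ.+ dbl j) ≡ 6)
  (s₀ : s 0 ≡ 1ℤ) (t₀ : t 0 ≡ 1ℤ)
  where

  s₁+t₁ : s 1 + t 1 ≡ + 2
  s₁+t₁ = correlation₁ (s 1) (t 1) s₀ t₀ (correlation 1)

  R₂ : ℕ
  R₂ = sumsq (s ∘ (2 ℕ.+_)) (2 ℕ.+ dbl j)

  norm₁ : sq (s 1) ℕ.+ (sq (t 1) ℕ.+ R₂) ≡ 4
  -- The outer coefficients, both 1, use up 2 of the total 6.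
  norm₁ = ℕ.+-cancelˡ-≡ 2 _ _ (begin
    2 ℕ.+ (sq (s 1) ℕ.+ (sq (t 1) ℕ.+ R₂))                             ≡⟨ cong (2 ℕ.+_) (sumsq-ends (s ∘ suc) _ (rev 1 _ refl)) ⟨
    2 ℕ.+ sumsq (s ∘ suc) (4 ℕ.+ dbl j)
      ≡⟨ cong₂ (λ x y → sq x ℕ.+ (sq y ℕ.+ sumsq (s ∘ suc) (4 ℕ.+ dbl j))) (sym s₀) (sym t₀) ⟩
    sq (s 0) ℕ.+ (sq (t 0) ℕ.+ sumsq (s ∘ suc) (4 ℕ.+ dbl j))           ≡⟨ sumsq-ends s _ (rev 0 _ refl) ⟨
    sumsq s (6 ℕ.+ dbl j)                                               ≡⟨ norm ⟩
    6                                                                   ∎)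
    where open ≡-Reasoning

  last : ∀ m → coeff (shift m (C 1ℤ)) m ≡ 1ℤ
  last m = trans (cong (coeff (shift m (C 1ℤ))) (sym (ℕ.+-identityʳ m))) (coeff-shift m (C 1ℤ) 0)

  s-is-T : s 1 ≡ + 2 → t 1 ≡ 0ℤ → R₂ ≡ 0 → SameUpTo (5 ℕ.+ dbl j) s (coeff (T j))
  s-is-T s₁ t₁ r zero          _ = s₀
  s-is-T s₁ t₁ r (suc zero)    _ = s₁
  s-is-T s₁ t₁ r (suc (suc i)) (s≤s (s≤s i≤)) with ℕ.m≤n⇒m<n∨m≡n i≤
  -- By reversal the two highest coefficients of `s` are `t 0` and `t 1`; those in between vanish
  -- because their squares sum to 0.
  ... | inj₂ refl = trans (sym (rev 0 _ refl)) (trans t₀ (sym (last (3 ℕ.+ dbl j))))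
  ... | inj₁ i< with ℕ.m≤n⇒m<n∨m≡n (ℕ.≤-pred i<)
  ...   | inj₂ refl = trans (sym (rev 1 _ refl)) (trans t₁ (sym (coeff-shift-< (3 ℕ.+ dbl j) (C 1ℤ) i i<)))
  ...   | inj₁ i<′ = trans (sumsq≡0 (s ∘ (2 ℕ.+_)) _ r i i<′) (sym (coeff-shift-< (3 ℕ.+ dbl j) (C 1ℤ) i i<))

  t-is-T : s 1 ≡ 0ℤ → t 1 ≡ + 2 → R₂ ≡ 0 → SameUpTo (5 ℕ.+ dbl j) t (coeff (T j))
  t-is-T s₁ t₁ r zero          _ = t₀
  t-is-T s₁ t₁ r (suc zero)    _ = t₁
  t-is-T s₁ t₁ r (suc (suc i)) (s≤s (s≤s i≤)) = helper (3 ℕ.+ dbl j ℕ.∸ i) (ℕ.m+[n∸m]≡n i≤)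
    where
    -- `l` is the index in `s` opposite to `2 + i` in `t`: 0 gives the leading coefficient of `t`, 1
    -- the next one, and the others fall under `R₂`.
    helper : ∀ l → i ℕ.+ l ≡ 3 ℕ.+ dbl j → t (2 ℕ.+ i) ≡ coeff (shift (3 ℕ.+ dbl j) (C 1ℤ)) i
    helper zero e = trans (rev (2 ℕ.+ i) 0 (cong (2 ℕ.+_) e)) (trans s₀ (sym (trans
      (cong (coeff (shift (3 ℕ.+ dbl j) (C 1ℤ))) (trans (sym (ℕ.+-identityʳ i)) e)) (last (3 ℕ.+ dbl j)))))
    helper (suc l) e = trans (rev (2 ℕ.+ i) (suc l) (cong (2 ℕ.+_) e)) (trans (vanish l e)
        (sym (coeff-shift-< (3 ℕ.+ dbl j) (C 1ℤ) i (subst (suc i ≤_) e (ℕ.m<m+n i (s≤s z≤n))))))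
      where
      vanish : ∀ l → i ℕ.+ suc l ≡ 3 ℕ.+ dbl j → s (suc l) ≡ 0ℤ
      vanish zero    _  = s₁
      vanish (suc l) e′ = sumsq≡0 (s ∘ (2 ℕ.+_)) _ r l
        (ℕ.≤-pred (subst (2 ℕ.+ l ≤_) e′ (ℕ.m≤n+m (2 ℕ.+ l) i)))

symmetric-impossible : ∀ j s t → (∀ i i′ → i ℕ.+ i′ ≡ 5 ℕ.+ dbl j → t i ≡ s i′) →
  (∀ i → conv s t i ≡ conv (coeff (T j)) (coeff (Tʳ j)) i) →
  s 0 ≡ 1ℤ → t 0 ≡ 1ℤ → s 1 ≡ 1ℤ → t 1 ≡ 1ℤ → sumsq (s ∘ (2 ℕ.+_)) (2 ℕ.+ dbl j) ≡ 2 → ⊥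
symmetric-impossible j s t rev correlation s₀ t₀ s₁ t₁ R₂≡2 = contradict j rev correlation R₃≡1
  where
  s₂+t₂ : s 2 + t 2 ≡ -[1+ 0 ]
  s₂+t₂ = correlation₂ (s 2) (t 2) s₀ t₀ s₁ t₁ (correlation 2)
  s₃+t₃ : s 3 + t 3 ≡ 1ℤ
  s₃+t₃ = correlation₃ (s 2) (t 2) (s 3) (t 3) s₀ t₀ s₁ t₁ s₂+t₂ (correlation 3)
  step₂ : s 2 * t 2 ≡ 0ℤ × sumsq (s ∘ (3 ℕ.+_)) (dbl j) ≡ 1
  step₂ = pair-sum--1 (s 2) (t 2) _ s₂+t₂ (trans (sym (sumsq-ends (s ∘ (2 ℕ.+_)) (dbl j) (rev 2 _ refl))) R₂≡2)
  R₃≡1 = proj₂ step₂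
  contradict : ∀ j → (∀ i i′ → i ℕ.+ i′ ≡ 5 ℕ.+ dbl j → t i ≡ s i′) →
    (∀ i → conv s t i ≡ conv (coeff (T j)) (coeff (Tʳ j)) i) → sumsq (s ∘ (3 ℕ.+_)) (dbl j) ≡ 1 → ⊥
  -- For n = 5 the coefficients 2 and 3 are the innermost pair, so no square can be left over.
  contradict zero    _   _    ()
  -- From n = 7 on, the terms of the product other than 1 + 2x lie beyond x^4, so its coefficient 4
  -- vanishes as well.
  contradict (suc j) rev corr R₃≡1 = end j rev R₄≡0
    where
    R₄≡0 : sumsq (s ∘ (4 ℕ.+_)) (dbl j) ≡ 0
    R₄≡0 = pair-sum-1 (s 3) (t 3) _ s₃+t₃ (trans (sym (sumsq-ends (s ∘ (3 ℕ.+_)) (dbl j) (rev 3 _ refl))) R₃≡1)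
    s₄+t₄ : s 4 + t 4 ≡ -[1+ 0 ]
    s₄+t₄ = correlation₄ (s 2) (t 2) (s 3) (t 3) (s 4) (t 4) s₀ t₀ s₁ t₁ (proj₁ step₂) s₃+t₃ (corr 4)
    end : ∀ j → (∀ i i′ → i ℕ.+ i′ ≡ 7 ℕ.+ dbl j → t i ≡ s i′) → sumsq (s ∘ (4 ℕ.+_)) (dbl j) ≡ 0 → ⊥
    -- For n = 7 the indices 3 and 4 are opposite, so `s 4 + t 4` equals `s 3 + t 3`, which is 1 and
    -- not -1.
    end zero rev _ with trans (sym s₄+t₄) (trans (cong₂ _+_ (sym (rev 3 4 refl)) (rev 4 3 refl))
      (trans (ℤ.+-comm (t 3) (s 3)) s₃+t₃))
    ... | ()
    -- For n at least 9, both `s 4` and `t 4` are among the coefficients already known to vanish.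
    end (suc j) rev R₄≡0 with trans (sym s₄+t₄) (cong₂ _+_ (zeros 0 (s≤s z≤n))
      (trans (rev 4 (5 ℕ.+ dbl j) refl) (zeros (suc (dbl j)) ℕ.≤-refl)))
      where
      zeros : ∀ i → suc i ≤ 2 ℕ.+ dbl j → s (4 ℕ.+ i) ≡ 0ℤ
      zeros = sumsq≡0 (s ∘ (4 ℕ.+_)) _ R₄≡0
    ... | ()

autocorrelation : ∀ j s t → (∀ i i′ → i ℕ.+ i′ ≡ 5 ℕ.+ dbl j → t i ≡ s i′) →
  (∀ i → conv s t i ≡ conv (coeff (T j)) (coeff (Tʳ j)) i) → sumsq s (6 ℕ.+ dbl j) ≡ 6 →
  s 0 ≡ 1ℤ → t 0 ≡ 1ℤ → SameUpTo (5 ℕ.+ dbl j) s (coeff (T j)) ⊎ SameUpTo (5 ℕ.+ dbl j) t (coeff (T j))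
autocorrelation j s t rev correlation norm s₀ t₀ with pair-sum-2 (s 1) (t 1) R₂ s₁+t₁ norm₁
  where open Autocorrelation j s t rev correlation norm s₀ t₀
... | inj₁ (s₁ , t₁ , r)        = inj₁ (Autocorrelation.s-is-T j s t rev correlation norm s₀ t₀ s₁ t₁ r)
... | inj₂ (inj₁ (s₁ , t₁ , r)) = inj₂ (Autocorrelation.t-is-T j s t rev correlation norm s₀ t₀ s₁ t₁ r)
... | inj₂ (inj₂ (s₁ , t₁ , r)) = ⊥-elim (symmetric-impossible j s t rev correlation s₀ t₀ s₁ t₁ r)

-- The trinomial, its reverse and their common factors

rv-monomial : ∀ m → rv m (shift m (C 1ℤ)) ≋ C 1ℤ
rv-monomial zero    = P.refl
rv-monomial (suc m) = P.trans (rv-0∷ m (shift m (C 1ℤ))) (rv-monomial m)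

X*shift : ∀ n p → X *P shift n p ≋ shift (suc n) p
X*shift n p = P.trans (0∷-* (C 1ℤ) (shift n p)) (∷-cong (P.*-identityˡ (shift n p)))

-- In terms of x and x^(n-1), the trinomial and its reverse have a shape independent of n, to which
-- the ring solver applies.
T-expand : ∀ j → T j ≋ X *P shift (4 ℕ.+ dbl j) (C 1ℤ) +P (C (+ 2) *P X +P C 1ℤ)
T-expand j = +P-congʳ (1ℤ ∷ + 2 ∷ []) {0ℤ ∷ shift (4 ℕ.+ dbl j) (C 1ℤ)} (P.sym (X*shift (4 ℕ.+ dbl j) (C 1ℤ)))

rv-T-expand : ∀ j → rv (5 ℕ.+ dbl j) (T j) ≋ X *P shift (4 ℕ.+ dbl j) (C 1ℤ) +P (C (+ 2) *P shift (4 ℕ.+ dbl j) (C 1ℤ) +P C 1ℤ)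
rv-T-expand j = P.+-cong (P.sym (X*shift (4 ℕ.+ dbl j) (C 1ℤ)))
  (P.+-cong (shift-C (4 ℕ.+ dbl j) (+ 2)) (rv-monomial (3 ℕ.+ dbl j)))

rv-T : ∀ j → rv (5 ℕ.+ dbl j) (T j) ≋ Tʳ j
rv-T j = begin
  shift (5 ℕ.+ dbl j) (C 1ℤ) +P (shift (4 ℕ.+ dbl j) (C (+ 2)) +P rv m (shift m (C 1ℤ)))
    ≈⟨ +P-congˡ (shift (5 ℕ.+ dbl j) (C 1ℤ)) (+P-congˡ (shift (4 ℕ.+ dbl j) (C (+ 2))) (rv-monomial m)) ⟩
  1ℤ ∷ (shift (suc m) (C 1ℤ) +P (shift m (C (+ 2)) +P []))
    ≈⟨ ∷-cong (+P-congˡ (shift (suc m) (C 1ℤ)) (P.+-identityʳ (shift m (C (+ 2))))) ⟩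
  1ℤ ∷ (shift (suc m) (C 1ℤ) +P shift m (C (+ 2)))  ≡⟨ cong (1ℤ ∷_) (merge m) ⟩
  Tʳ j ∎
  where
  open ≋-Reasoning
  m = 3 ℕ.+ dbl j
  merge : ∀ m → shift (suc m) (C 1ℤ) +P shift m (C (+ 2)) ≡ shift m (+ 2 ∷ 1ℤ ∷ [])
  merge zero    = refl
  merge (suc m) = cong (0ℤ ∷_) (merge m)

sumsq-T : ∀ j → sumsq (coeff (T j)) (6 ℕ.+ dbl j) ≡ 6
sumsq-T j = cong (5 ℕ.+_) (monomial (3 ℕ.+ dbl j))
  where
  monomial : ∀ m → sumsq (coeff (shift m (C 1ℤ))) (suc m) ≡ 1
  monomial zero    = refl
  monomial (suc m) = monomial m

T-below : ∀ j → Below (T j) (6 ℕ.+ dbl j)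
T-below j i n<i = at-top i (subst (λ m → suc (suc m) ≤ i) (ℕ.+-comm 1 (3 ℕ.+ dbl j)) n<i)
  where
  at-top : ∀ i → 2 ℕ.+ (3 ℕ.+ dbl j ℕ.+ 1) ≤ i → coeff (T j) i ≡ 0ℤ
  at-top (suc (suc i)) (s≤s (s≤s le)) = shift-below (3 ℕ.+ dbl j) (C 1ℤ) (C-below 1ℤ) i le

T-top : ∀ j → coeff (T j) (5 ℕ.+ dbl j) ≡ 1ℤ
T-top j = trans (cong (coeff (shift (3 ℕ.+ dbl j) (C 1ℤ))) (sym (ℕ.+-identityʳ (3 ℕ.+ dbl j)))) (coeff-shift (3 ℕ.+ dbl j) (C 1ℤ) 0)

T-deg : ∀ j → Deg (T j) (5 ℕ.+ dbl j)
T-deg j = deg (λ e → 1≢0 (trans (sym (T-top j)) e)) (T-below j)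
  where
  1≢0 : 1ℤ ≢ 0ℤ
  1≢0 ()

-- Induction by x^(m+2) + 1 = x^2 (x^m + 1) - (x + 1)(x - 1).
x^odd+1 : ∀ i → ∃ λ W → shift (suc (dbl i)) (C 1ℤ) +P C 1ℤ ≋ (X +P C 1ℤ) *P W
x^odd+1 zero    = C 1ℤ , P.refl
x^odd+1 (suc i) with x^odd+1 i
... | W , e = X *P X *P W +P -P (X +P -P C 1ℤ) , (begin
  shift (3 ℕ.+ dbl i) (C 1ℤ) +P C 1ℤ    ≈⟨ +P-congʳ (C 1ℤ) X²S ⟨
  X *P (X *P S) +P C 1ℤ
    ≈⟨ solve 2 (λ x s → x :* (x :* s) :+ con 1ℤ := x :* x :* (s :+ con 1ℤ) :- (x :+ con 1ℤ) :* (x :- con 1ℤ)) P.refl X S ⟩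
  X *P X *P (S +P C 1ℤ) +P -P ((X +P C 1ℤ) *P (X +P -P C 1ℤ))
    ≈⟨ +P-congʳ (-P ((X +P C 1ℤ) *P (X +P -P C 1ℤ))) (*P-congˡ (X *P X) e) ⟩
  X *P X *P ((X +P C 1ℤ) *P W) +P -P ((X +P C 1ℤ) *P (X +P -P C 1ℤ))
    ≈⟨ solve 2 (λ x w → x :* x :* ((x :+ con 1ℤ) :* w) :- (x :+ con 1ℤ) :* (x :- con 1ℤ)
                     := (x :+ con 1ℤ) :* (x :* x :* w :- (x :- con 1ℤ))) P.refl X W ⟩
  (X +P C 1ℤ) *P (X *P X *P W +P -P (X +P -P C 1ℤ)) ∎)
  where
  open ≋-Reasoning
  S = shift (suc (dbl i)) (C 1ℤ)
  X²S : X *P (X *P S) ≋ shift (3 ℕ.+ dbl i) (C 1ℤ)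
  X²S = P.trans (*P-congˡ X (X*shift (suc (dbl i)) (C 1ℤ))) (X*shift (2 ℕ.+ dbl i) (C 1ℤ))

-- Modulo a common factor of x^n + 2x + 1 and its reverse we have 2(x + 1)² ≡ 0, and x + 1 divides 2
-- since x + 1 divides x^n + 1 (n is odd); hence 8 ≡ 0.
no-common-factor : ∀ j q r r′ → NonConstant q → q *P r ≋ T j → q *P r′ ≋ rv (5 ℕ.+ dbl j) (T j) → ⊥
no-common-factor j q r r′ Q e e′ = ∤const {q} (λ ()) Q (begin
  -- The identity behind the chain is 2 (T + 2)^2 - T (2 T + 8) = 8, where `q` divides both terms on
  -- the left.
  q *P (U *P V *P V +P -P (r *P (C (+ 2) *P T j +P C (+ 8))))
    ≈⟨ solve 5 (λ q u v r t → q :* (u :* v :* v :- r :* (con (+ 2) :* t :+ con (+ 8)))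
              := q :* u :* v :* v :- q :* r :* (con (+ 2) :* t :+ con (+ 8))) P.refl q U V r (T j) ⟩
  q *P U *P V *P V +P -P (q *P r *P (C (+ 2) *P T j +P C (+ 8)))
    ≈⟨ P.+-cong (*P-congʳ V (*P-congʳ V 2[X+1]²)) (P.-‿cong (*P-congʳ (C (+ 2) *P T j +P C (+ 8)) e)) ⟩
  C (+ 2) *P (X +P C 1ℤ) *P (X +P C 1ℤ) *P V *P V +P -P (T j *P (C (+ 2) *P T j +P C (+ 8)))
    ≈⟨ solve 3 (λ y v t → con (+ 2) :* y :* y :* v :* v :- t :* (con (+ 2) :* t :+ con (+ 8))
              := con (+ 2) :* (y :* v) :* (y :* v) :- t :* (con (+ 2) :* t :+ con (+ 8))) P.refl (X +P C 1ℤ) V (T j) ⟩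
  C (+ 2) *P ((X +P C 1ℤ) *P V) *P ((X +P C 1ℤ) *P V) +P -P (T j *P (C (+ 2) *P T j +P C (+ 8)))
    ≈⟨ +P-congʳ _ (P.*-cong (*P-congˡ (C (+ 2)) T+2) T+2) ⟨
  C (+ 2) *P (T j +P C (+ 2)) *P (T j +P C (+ 2)) +P -P (T j *P (C (+ 2) *P T j +P C (+ 8)))
    ≈⟨ solve 1 (λ t → con (+ 2) :* (t :+ con (+ 2)) :* (t :+ con (+ 2)) :- t :* (con (+ 2) :* t :+ con (+ 8)) := con (+ 8)) P.refl (T j) ⟩
  C (+ 8) ∎)
  where
  open ≋-Reasoning
  Z = shift (4 ℕ.+ dbl j) (C 1ℤ)
  W = proj₁ (x^odd+1 (2 ℕ.+ j))
  -- T + 2 = (x^n + 1) + 2 (x + 1), so x + 1 splits off with cofactor `V`.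
  V = W +P C (+ 2)
  -- In (2 + x) T - x rev T all high powers of x cancel, leaving 2 (x + 1)^2.
  U = (C (+ 2) +P X) *P r +P -P (X *P r′)
  2[X+1]² : q *P U ≋ C (+ 2) *P (X +P C 1ℤ) *P (X +P C 1ℤ)
  2[X+1]² = begin
    q *P U  ≈⟨ solve 4 (λ q r r′ x → q :* ((con (+ 2) :+ x) :* r :- x :* r′) := (con (+ 2) :+ x) :* (q :* r) :- x :* (q :* r′)) P.refl q r r′ X ⟩
    (C (+ 2) +P X) *P (q *P r) +P -P (X *P (q *P r′))
      ≈⟨ P.+-cong (*P-congˡ (C (+ 2) +P X) (P.trans e (T-expand j))) (P.-‿cong (*P-congˡ X (P.trans e′ (rv-T-expand j)))) ⟩
    (C (+ 2) +P X) *P (X *P Z +P (C (+ 2) *P X +P C 1ℤ)) +P -P (X *P (X *P Z +P (C (+ 2) *P Z +P C 1ℤ)))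
      ≈⟨ solve 2 (λ x z → (con (+ 2) :+ x) :* (x :* z :+ (con (+ 2) :* x :+ con 1ℤ)) :- x :* (x :* z :+ (con (+ 2) :* z :+ con 1ℤ))
                := con (+ 2) :* (x :+ con 1ℤ) :* (x :+ con 1ℤ)) P.refl X Z ⟩
    C (+ 2) *P (X +P C 1ℤ) *P (X +P C 1ℤ) ∎
  T+2 : T j +P C (+ 2) ≋ (X +P C 1ℤ) *P V
  T+2 = begin
    T j +P C (+ 2) ≈⟨ +P-congʳ (C (+ 2)) (T-expand j) ⟩
    X *P Z +P (C (+ 2) *P X +P C 1ℤ) +P C (+ 2)
      ≈⟨ solve 2 (λ x s → s :+ (con (+ 2) :* x :+ con 1ℤ) :+ con (+ 2) := (s :+ con 1ℤ) :+ (x :+ con 1ℤ) :* con (+ 2)) P.refl X (X *P Z) ⟩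
    (X *P Z +P C 1ℤ) +P (X +P C 1ℤ) *P C (+ 2)
      ≈⟨ +P-congʳ ((X +P C 1ℤ) *P C (+ 2)) (P.trans (+P-congʳ (C 1ℤ) (X*shift (4 ℕ.+ dbl j) (C 1ℤ))) (proj₂ (x^odd+1 (2 ℕ.+ j)))) ⟩
    (X +P C 1ℤ) *P W +P (X +P C 1ℤ) *P C (+ 2) ≈⟨ P.distribˡ (X +P C 1ℤ) W (C (+ 2)) ⟨
    (X +P C 1ℤ) *P V ∎

-- Irreducibility of the trinomial

SameUpTo⇒≋ : ∀ {n} p q → Below p (suc n) → Below q (suc n) → SameUpTo n (coeff p) (coeff q) → p ≋ q
SameUpTo⇒≋ {n} p q P Q same = mk≋ coeffs
  where
  coeffs : p ≈P q
  coeffs i with i ℕ.≤? n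
  ... | yes i≤n = same i i≤n
  ... | no  i≰n = trans (P i (ℕ.≰⇒> i≰n)) (sym (Q i (ℕ.≰⇒> i≰n)))

x*y≡1 : ∀ x y → x * y ≡ 1ℤ → (x ≡ 1ℤ × y ≡ 1ℤ) ⊎ (x ≡ -[1+ 0 ] × y ≡ -[1+ 0 ])
x*y≡1 x y e with ℕ.m*n≡1⇒m≡1 ∣ x ∣ ∣ y ∣ (trans (sym (ℤ.abs-* x y)) (cong ∣_∣ e))
x*y≡1 (+ 1)    y e | refl = inj₁ (refl , trans (sym (ℤ.*-identityˡ y)) e)
x*y≡1 -[1+ 0 ] y e | refl = inj₂ (refl , trans (sym (ℤ.neg-involutive y)) (cong -_ (trans (sym (ℤ.-1*i≡-i y)) e)))

-- The middle coefficients on both sides are sums of squares, so that of `k` is 6 and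
-- `autocorrelation` applies. If it identifies the reverse of `k`, reversing once more identifies
-- `k`.
same-correlation⁺ : ∀ j k → Below k (6 ℕ.+ dbl j) →
  k *P rv (5 ℕ.+ dbl j) k ≋ T j *P rv (5 ℕ.+ dbl j) (T j) →
  coeff k 0 ≡ 1ℤ → coeff (rv (5 ℕ.+ dbl j) k) 0 ≡ 1ℤ →
  k ≋ T j ⊎ k ≋ rv (5 ℕ.+ dbl j) (T j)
same-correlation⁺ j k K e k₀ kₙ with autocorrelation j (coeff k) (coeff (rv n k)) (coeff-rv n k)
    (λ i → trans (correlation i) (conv-cong {coeff (T j)} (λ _ → refl) (at (rv-T j)) i)) norm k₀ kₙ
  where
  n = 5 ℕ.+ dbl j
  correlation : ∀ i → conv (coeff k) (coeff (rv n k)) i ≡ conv (coeff (T j)) (coeff (rv n (T j))) i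
  correlation i = trans (sym (coeff-*P k (rv n k) i)) (trans (at e i) (coeff-*P (T j) (rv n (T j)) i))
  norm-rv : ∀ p → conv (coeff p) (coeff (rv n p)) n ≡ + sumsq (coeff p) (suc n)
  norm-rv p = conv-reverse n λ i i′ e → coeff-rv n p i′ i (trans (ℕ.+-comm i′ i) e)
  norm : sumsq (coeff k) (suc n) ≡ 6
  norm = trans (ℤ.+-injective (trans (sym (norm-rv k)) (trans (correlation n) (norm-rv (T j))))) (sumsq-T j)
... | inj₁ same = inj₁ (SameUpTo⇒≋ k (T j) K (T-below j) same)
... | inj₂ same = inj₂ (P.trans (P.sym (rv-rv (5 ℕ.+ dbl j) k K))
  (rv-cong (5 ℕ.+ dbl j) (SameUpTo⇒≋ (rv (5 ℕ.+ dbl j) k) (T j) (rv-below (5 ℕ.+ dbl j) k) (T-below j) same)))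

-- The constant coefficients of `k` and of its reverse have product 1, so both are 1 or both are -1;
-- in the second case the argument runs for -k.
same-correlation : ∀ j k → Below k (6 ℕ.+ dbl j) →
  k *P rv (5 ℕ.+ dbl j) k ≋ T j *P rv (5 ℕ.+ dbl j) (T j) →
  ∃ λ ε → (C ε *P k ≋ T j ⊎ C ε *P k ≋ rv (5 ℕ.+ dbl j) (T j))
same-correlation j k K e
  with x*y≡1 (coeff k 0) (coeff (rv (5 ℕ.+ dbl j) k) 0) (trans (sym (coeff-*P k (rv (5 ℕ.+ dbl j) k) 0))
         (trans (at e 0) (trans (coeff-*P (T j) (rv (5 ℕ.+ dbl j) (T j)) 0) (cong (1ℤ *_) (at (rv-T j) 0)))))
... | inj₁ (k₀ , kₙ) = 1ℤ , Sum.map (P.trans (P.*-identityˡ k)) (P.trans (P.*-identityˡ k)) (same-correlation⁺ j k K e k₀ kₙ)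
... | inj₂ (k₀ , kₙ) = -1ℤ , same-correlation⁺ j k′ K′ e′ (trans (coeff-C* -1ℤ k 0) (cong (-1ℤ *_) k₀))
    (trans (at (rv-C* n -1ℤ k) 0) (trans (coeff-C* -1ℤ (rv n k) 0) (cong (-1ℤ *_) kₙ)))
  where
  open ≋-Reasoning
  n = 5 ℕ.+ dbl j
  k′ = C -1ℤ *P k
  K′ : Below k′ (suc n)
  K′ i n<i = trans (coeff-C* -1ℤ k i) (cong (-1ℤ *_) (K i n<i))
  e′ : k′ *P rv n k′ ≋ T j *P rv n (T j)
  e′ = begin
    k′ *P rv n k′                    ≈⟨ *P-congˡ k′ (rv-C* n -1ℤ k) ⟩
    k′ *P (C -1ℤ *P rv n k)          ≈⟨ solve 2 (λ p q → (con -1ℤ :* p) :* (con -1ℤ :* q) := p :* q) P.refl k (rv n k) ⟩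
    k *P rv n k                      ≈⟨ e ⟩
    T j *P rv n (T j)                ∎

T-irreducible : ∀ j g h → NonConstant g → NonConstant h → ¬ (g *P h ≋ T j)
T-irreducible j g h G H gh≋T with NonConstant⇒Deg g G | NonConstant⇒Deg h H
... | d′ , Dg | e′ , Dh = conclude (same-correlation j k
      (subst (Below k ∘ suc) d+e≡n (Below-* {g} {h~} d e (below Dg) (rv-below e h))) correlated)
  where
  open ≋-Reasoning
  n = 5 ℕ.+ dbl j
  d = suc d′
  e = suc e′
  g~ = rv d g
  h~ = rv e h
  k = g *P h~
  d+e≡n : d ℕ.+ e ≡ n
  d+e≡n = Deg-unique (Deg-cong gh≋T (Deg-* Dg Dh)) (T-deg j)
  rv-n : ∀ p q → Below p (suc d) → Below q (suc e) → rv n (p *P q) ≋ rv d p *P rv e q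
  rv-n p q P Q = subst (λ m → rv m (p *P q) ≋ rv d p *P rv e q) d+e≡n (rv-* d e p q P Q)
  rv-T≋ : g~ *P h~ ≋ rv n (T j)
  rv-T≋ = P.trans (P.sym (rv-n g h (below Dg) (below Dh))) (rv-cong n gh≋T)
  correlated : k *P rv n k ≋ T j *P rv n (T j)
  correlated = begin
    k *P rv n k                   ≈⟨ *P-congˡ k (rv-n g h~ (below Dg) (rv-below e h)) ⟩
    g *P h~ *P (g~ *P rv e h~)    ≈⟨ *P-congˡ k (*P-congˡ g~ (rv-rv e h (below Dh))) ⟩
    g *P h~ *P (g~ *P h)          ≈⟨ solve 4 (λ g h g′ h′ → g :* h′ :* (g′ :* h) := g :* h :* (g′ :* h′)) P.refl g h g~ h~ ⟩
    g *P h *P (g~ *P h~)          ≈⟨ P.*-cong gh≋T rv-T≋ ⟩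
    T j *P rv n (T j)             ∎
  conclude : ¬ (∃ λ ε → (C ε *P k ≋ T j ⊎ C ε *P k ≋ rv n (T j)))
  -- Here `h~` divides both `T j` and its reverse `g~ *P h~`; it is nonconstant because cancelling
  -- `g` makes `h` a multiple of it by `ε`.
  conclude (ε , inj₁ εk≋T) = no-common-factor j h~ (C ε *P g) g~ (NonConstant-C* ε εh~≋h H)
      (P.trans (solve 3 (λ ε g h → h :* (ε :* g) := ε :* (g :* h)) P.refl (C ε) g h~) εk≋T)
      (P.trans (P.*-comm h~ g~) rv-T≋)
    where
    εh~≋h : C ε *P h~ ≋ h
    εh~≋h = *P-cancelˡ Dg (begin
      g *P (C ε *P h~)    ≈⟨ solve 3 (λ ε g h → g :* (ε :* h) := ε :* (g :* h)) P.refl (C ε) g h~ ⟩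
      C ε *P k            ≈⟨ εk≋T ⟩
      T j                 ≈⟨ gh≋T ⟨
      g *P h              ∎)
  -- Here `g` divides both `T j` and, through `k`, its reverse.
  conclude (ε , inj₂ εk≋rvT) = no-common-factor j g h (C ε *P h~) G gh≋T
    (P.trans (solve 3 (λ ε g h → g :* (ε :* h) := ε :* (g :* h)) P.refl (C ε) g h~) εk≋rvT)

-- An irreducible polynomial over ℤ is prime over ℚ

coeff-∷* : ∀ c p q n → coeff ((c ∷ p) *P q) (suc n) ≡ c * coeff q (suc n) + coeff (p *P q) n
coeff-∷* c p q n = trans (coeff-+P (map (c *_) q) _ (suc n)) (cong (_+ coeff (p *P q) n) (coeff-scale c q (suc n)))

prime-∣* : ∀ {p} → Prime p → ∀ x y → + p ∣ x * y → (+ p ∣ x) ⊎ (+ p ∣ y)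
prime-∣* {p} pr x y p∣xy = Sum.map ∣ᵤ⇒∣ ∣ᵤ⇒∣
  (euclidsLemma ∣ x ∣ ∣ y ∣ pr (subst (p ℕ∣.∣_) (ℤ.abs-* x y) (∣⇒∣ᵤ p∣xy)))

infix 4 _∣ᶜ_
_∣ᶜ_ : ℤ → Poly → Set
z ∣ᶜ p = ∀ n → z ∣ coeff p n

∣ᶜ-resp-≋ : ∀ {z p q} → p ≋ q → z ∣ᶜ p → z ∣ᶜ q
∣ᶜ-resp-≋ {z} e d n = subst (z ∣_) (at e n) (d n)

-- The prime divides the product of the constant coefficients, hence one of them. Dropping that
-- coefficient keeps the product divisible by the prime, so the induction shortens one of the lists
-- until it is empty.
gauss : ∀ {p} → Prime p → ∀ P Q → + p ∣ᶜ P *P Q → + p ∣ᶜ P ⊎ + p ∣ᶜ Q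
gauss pr []       Q        d = inj₁ λ n → divides 0ℤ refl
gauss pr (c ∷ cs) []       d = inj₂ λ n → divides 0ℤ refl
gauss {p} pr (c ∷ cs) (e ∷ es) d = Sum.[
  (λ p∣c → Sum.map₁ (λ { p∣cs zero → p∣c ; p∣cs (suc n) → p∣cs n }) (gauss pr cs (e ∷ es)
    λ n → ∣m+n∣m⇒∣n (subst (+ p ∣_) (coeff-∷* c cs (e ∷ es) n) (d (suc n))) (∣m⇒∣m*n _ p∣c))) ,
  (λ p∣e → Sum.map₂ (λ { p∣es zero → p∣e ; p∣es (suc n) → p∣es n }) (gauss pr (c ∷ cs) es
    (∣ᶜ-resp-≋ (P.*-comm es (c ∷ cs)) λ n → ∣m+n∣m⇒∣n (subst (+ p ∣_) (coeff-∷* e es (c ∷ cs) n)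
      (∣ᶜ-resp-≋ (P.*-comm (c ∷ cs) (e ∷ es)) d (suc n))) (∣m⇒∣m*n _ p∣e)))) ]
  (prime-∣* pr c e (subst (+ p ∣_) (coeff-*P (c ∷ cs) (e ∷ es) 0) (d 0)))

divide : ∀ {z} p → z ∣ᶜ p → ∃ λ q → C z *P q ≋ p
divide []      d = [] , mk≋ λ { zero → refl ; (suc n) → refl }
divide {z} (c ∷ p) d with d 0 | divide p (d ∘ suc)
... | divides q c≡qz | q′ , e = q ∷ q′ , mk≋ λ
  { zero    → trans (coeff-C* z (q ∷ q′) 0) (trans (ℤ.*-comm z q) (sym c≡qz))
  ; (suc n) → trans (coeff-C* z (q ∷ q′) (suc n)) (trans (sym (coeff-C* z q′ n)) (at e n)) }

C*-∣ᶜ : ∀ z p → z ∣ᶜ C z *P p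
C*-∣ᶜ z p n = divides (coeff p n) (trans (coeff-C* z p n) (ℤ.*-comm z _))

C*-cancel : ∀ {z p q} → z ≢ 0ℤ → C z *P p ≋ C z *P q → p ≋ q
C*-cancel z≢0 = *P-cancelˡ (C-deg z≢0)

-- Horner's scheme: from e p = q D + r follows e (c + x p) = x q D + (e c + x r). The new remainder
-- has degree at most `d`; multiplying by the leading coefficient of `D`, which avoids fractions,
-- allows its term of degree `d` to be cancelled.
pseudo-division : ∀ {D d} → Deg D d → ∀ p → ∃ λ e → ∃₂ λ q r → e ≢ 0ℤ × C e *P p ≋ q *P D +P r × Below r d
pseudo-division D-deg [] = 1ℤ , [] , [] , (λ ()) , mk≋ (λ { zero → refl ; (suc n) → refl }) , λ _ _ → refl
pseudo-division {D} {d} D-deg (c ∷ p) with pseudo-division D-deg p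
... | e , q , r , e≢0 , ep≋qD+r , r-below =
  l * e , C l *P (0ℤ ∷ q) +P C (coeff r₁ d) , C l *P r₁ +P -P (C (coeff r₁ d) *P D) , m*n≢0 (lead D-deg) e≢0 , eq , r-below′
  where
  open ≋-Reasoning
  l = coeff D d
  r₁ = e * c ∷ r
  step : C e *P (c ∷ p) ≋ (0ℤ ∷ q) *P D +P r₁
  step = begin
    C e *P (c ∷ p)                  ≈⟨ mk≋ (λ { zero → coeff-C* e (c ∷ p) 0 ; (suc n) → trans (coeff-C* e (c ∷ p) (suc n)) (sym (coeff-C* e p n)) }) ⟩
    e * c ∷ (C e *P p)              ≈⟨ ∷-cong ep≋qD+r ⟩
    e * c ∷ (q *P D +P r)           ≡⟨ cong (_∷ (q *P D +P r)) (sym (ℤ.+-identityˡ (e * c))) ⟩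
    (0ℤ ∷ (q *P D)) +P r₁           ≈⟨ +P-congʳ r₁ (0∷-* q D) ⟨
    (0ℤ ∷ q) *P D +P r₁             ∎
  eq : C (l * e) *P (c ∷ p) ≋ (C l *P (0ℤ ∷ q) +P C (coeff r₁ d)) *P D +P (C l *P r₁ +P -P (C (coeff r₁ d) *P D))
  eq = begin
    C (l * e) *P (c ∷ p)              ≈⟨ *P-congʳ (c ∷ p) (C-* l e) ⟩
    C l *P C e *P (c ∷ p)             ≈⟨ P.*-assoc (C l) (C e) (c ∷ p) ⟩
    C l *P (C e *P (c ∷ p))           ≈⟨ *P-congˡ (C l) step ⟩
    C l *P ((0ℤ ∷ q) *P D +P r₁)
      ≈⟨ solve 5 (λ l q D r t → l :* (q :* D :+ r) := (l :* q :+ t) :* D :+ (l :* r :- t :* D)) P.refl (C l) (0ℤ ∷ q) D r₁ (C (coeff r₁ d)) ⟩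
    (C l *P (0ℤ ∷ q) +P C (coeff r₁ d)) *P D +P (C l *P r₁ +P -P (C (coeff r₁ d) *P D)) ∎
  coeffs : ∀ i → coeff (C l *P r₁ +P -P (C (coeff r₁ d) *P D)) i ≡ l * coeff r₁ i - coeff r₁ d * coeff D i
  coeffs i rewrite coeff-+P (C l *P r₁) (-P (C (coeff r₁ d) *P D)) i | coeff--P (C (coeff r₁ d) *P D) i
    | coeff-C* l r₁ i | coeff-C* (coeff r₁ d) D i = refl
  r-below′ : Below (C l *P r₁ +P -P (C (coeff r₁ d) *P D)) d
  r-below′ i d≤i with ℕ.m≤n⇒m<n∨m≡n d≤i
  ... | inj₂ refl = trans (coeffs i) (trans (cong (λ z → l * coeff r₁ i - z) (ℤ.*-comm (coeff r₁ i) l)) (ℤ.+-inverseʳ (l * coeff r₁ i)))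
  r-below′ (suc i) _ | inj₁ d<i = trans (coeffs (suc i)) (trans (cong₂ (λ y z → l * y - coeff r₁ d * z) (r-below i (ℕ.≤-pred d<i)) (below D-deg (suc i) d<i))
    (lemma l (coeff r₁ d)))
    where
    lemma : ∀ x y → x * 0ℤ - y * 0ℤ ≡ 0ℤ
    lemma = solve-∀

infix 4 _∣P_ _∣ℚ_
record _∣P_ (p q : Poly) : Set where
  constructor cofactor
  field
    quotient : Poly
    equation : q ≋ p *P quotient

∣P-refl : ∀ p → p ∣P p
∣P-refl p = cofactor (C 1ℤ) (P.sym (P.*-identityʳ p))

∣P-resp-≋ : ∀ {p q r} → q ≋ r → p ∣P q → p ∣P r
∣P-resp-≋ e (cofactor s q≋ps) = cofactor s (P.trans (P.sym e) q≋ps)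

∣P-+ : ∀ {p q r} → p ∣P q → p ∣P r → p ∣P q +P r
∣P-+ {p} (cofactor s q≋ps) (cofactor t r≋pt) = cofactor (s +P t) (P.trans (P.+-cong q≋ps r≋pt) (P.sym (P.distribˡ p s t)))

∣P-* : ∀ {p q} r → p ∣P q → p ∣P r *P q
∣P-* {p} r (cofactor s q≋ps) = cofactor (r *P s)
  (P.trans (*P-congˡ r q≋ps) (solve 3 (λ r p s → r :* (p :* s) := p :* (r :* s)) P.refl r p s))

-- Divisibility in ℚ[x], with denominators cleared.
_∣ℚ_ : Poly → Poly → Set
p ∣ℚ q = ∃ λ c → c ≢ 0ℤ × p ∣P C c *P q

module IrreducibleIsPrime (F : Poly) (n : ℕ) (F-deg : Deg F n)
  (F-irreducible : ∀ g h → NonConstant g → NonConstant h → ¬ (g *P h ≋ F)) where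

  -- By Gauss's lemma each prime of the constant divides `g` or `h` and can be divided out; at the
  -- end a factorisation of `F` itself remains.
  irreducible-product : ∀ {ps} → All Prime ps → ∀ g h → NonConstant g → NonConstant h →
    ¬ (g *P h ≋ C (+ product ps) *P F)
  irreducible-product [] g h G H e = F-irreducible g h G H (P.trans e (P.*-identityˡ (F)))
  irreducible-product {p ∷ ps} (pr ∷ prs) g h G H e = split (gauss pr g h (∣ᶜ-resp-≋ (P.sym e′) (C*-∣ᶜ (+ p) mF)))
    where
    open ≋-Reasoning
    mF = C (+ product ps) *P F
    p≢0 : + p ≢ 0ℤ
    p≢0 p≡0 = ℕ.≢-nonZero⁻¹ p {{prime⇒nonZero pr}} (ℤ.+-injective p≡0)
    e′ : g *P h ≋ C (+ p) *P mF
    e′ = begin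
      g *P h                                ≈⟨ e ⟩
      C (+ (p ℕ.* product ps)) *P F       ≡⟨ cong (λ c → C c *P F) (ℤ.pos-* p (product ps)) ⟩
      C (+ p * + product ps) *P F         ≈⟨ *P-congʳ (F) (C-* (+ p) (+ product ps)) ⟩
      C (+ p) *P C (+ product ps) *P F    ≈⟨ P.*-assoc (C (+ p)) (C (+ product ps)) (F) ⟩
      C (+ p) *P mF                         ∎
    split : ¬ (+ p ∣ᶜ g ⊎ + p ∣ᶜ h)
    split (inj₁ p∣g) with divide g p∣g
    ... | g′ , pg′≋g = irreducible-product prs g′ h (NonConstant-C* (+ p) pg′≋g G) H (C*-cancel p≢0 (begin
      C (+ p) *P (g′ *P h)  ≈⟨ P.*-assoc (C (+ p)) g′ h ⟨
      C (+ p) *P g′ *P h    ≈⟨ *P-congʳ h pg′≋g ⟩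
      g *P h                ≈⟨ e′ ⟩
      C (+ p) *P mF         ∎))
    split (inj₂ p∣h) with divide h p∣h
    ... | h′ , ph′≋h = irreducible-product prs g h′ G (NonConstant-C* (+ p) ph′≋h H) (C*-cancel p≢0 (begin
      C (+ p) *P (g *P h′)  ≈⟨ solve 3 (λ p g h → p :* (g :* h) := g :* (p :* h)) P.refl (C (+ p)) g h′ ⟩
      g *P (C (+ p) *P h′)  ≈⟨ *P-congˡ g ph′≋h ⟩
      g *P h                ≈⟨ e′ ⟩
      C (+ p) *P mF         ∎))

  irreducible-ℕ : ∀ m → m ≢ 0 → ∀ g h → NonConstant g → NonConstant h → ¬ (g *P h ≋ C (+ m) *P F)
  irreducible-ℕ m m≢0 g h G H e = irreducible-product factorsPrime g h G H
    (subst (λ m → g *P h ≋ C (+ m) *P F) isFactorisation e)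
    where open PrimeFactorisation (factorise m {{ℕ.≢-nonZero m≢0}})

  irreducible-ℚ : ∀ {c} → c ≢ 0ℤ → ∀ g h → NonConstant g → NonConstant h → ¬ (g *P h ≋ C c *P F)
  irreducible-ℚ {+ m}      c≢0 g h G H e = irreducible-ℕ m (λ m≡0 → c≢0 (cong +_ m≡0)) g h G H e
  irreducible-ℚ { -[1+ m ]} c≢0 g h G H e = irreducible-ℕ (suc m) (λ ()) (C -1ℤ *P g) h
    (NonConstant-C* -1ℤ (solve 1 (λ g → con -1ℤ :* (con -1ℤ :* g) := g) P.refl g) G) H (begin
      C -1ℤ *P g *P h               ≈⟨ P.*-assoc (C -1ℤ) g h ⟩
      C -1ℤ *P (g *P h)             ≈⟨ *P-congˡ (C -1ℤ) e ⟩
      C -1ℤ *P (C -[1+ m ] *P F)  ≈⟨ solve 2 (λ c t → con -1ℤ :* (c :* t) := (:- c) :* t) P.refl (C -[1+ m ]) (F) ⟩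
      C (+ suc m) *P F            ∎)
    where open ≋-Reasoning

  -- `F` is divided by `r`, and the argument continues with `F` and the remainder, whose degree is
  -- smaller. A zero remainder would factor a multiple of `F`, with nonconstant quotient since `r`
  -- has degree less than `n`. The bound `b` carries the recursion.
  bezout : ∀ b {r d} → d ≤ b → suc d ≤ n → Deg r d → ∃₂ λ s u → ∃ λ c → c ≢ 0ℤ × s *P F +P u *P r ≋ C c
  bezout b {r} {zero} _ _ D with Deg0⇒const D
  ... | c , c≢0 , r≋c = [] , C 1ℤ , c , c≢0 , P.trans (P.*-identityˡ r) r≋c
  bezout (suc b) {r} {suc d} (s≤s d≤b) d<n D with pseudo-division D (F)
  ... | e , q , r′ , e≢0 , eF≋qr+r′ , r′-below with zero-or-degree r′
  ...   | inj₁ r′≋0 = ⊥-elim (irreducible-ℚ e≢0 q r q-nonconstant (Deg⇒NonConstant D) qr≋eF)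
    where
    open ≋-Reasoning
    qr≋eF : q *P r ≋ C e *P F
    qr≋eF = begin
      q *P r           ≈⟨ P.+-identityʳ (q *P r) ⟨
      q *P r +P []     ≈⟨ +P-congˡ (q *P r) r′≋0 ⟨
      q *P r +P r′     ≈⟨ eF≋qr+r′ ⟨
      C e *P F       ∎
    eF-deg : Deg (C e *P F) (n)
    eF-deg = Deg-* (C-deg e≢0) (F-deg)
    q-nonconstant : NonConstant q
    q-nonconstant with zero-or-degree q
    ... | inj₁ q≋0 = ⊥-elim (¬Deg[] (P.trans (P.sym qr≋eF) (*P-congʳ r q≋0)) eF-deg)
    ... | inj₂ (suc _ , Q) = Deg⇒NonConstant Q
    ... | inj₂ (zero , Q) = ⊥-elim (ℕ.<-irrefl (Deg-unique (Deg-cong qr≋eF (Deg-* Q D)) eF-deg) d<n)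
  ...   | inj₂ (d′ , D′) with ℕ.≤-pred (Deg-< D′ r′-below)
  ...     | d′≤d with bezout b (ℕ.≤-trans d′≤d d≤b) (ℕ.≤-trans (s≤s d′≤d) (ℕ.≤-trans (ℕ.n≤1+n _) d<n)) D′
  ...       | s , u , c , c≢0 , sF+ur′≋c = s +P u *P C e , -P (u *P q) , c , c≢0 , (begin
    (s +P u *P C e) *P F +P -P (u *P q) *P r
      ≈⟨ solve 6 (λ s u e t q r → (s :+ u :* e) :* t :+ (:- (u :* q)) :* r := s :* t :+ u :* (e :* t :- q :* r)) P.refl s u (C e) (F) q r ⟩
    s *P F +P u *P (C e *P F +P -P (q *P r))       ≈⟨ +P-congˡ (s *P F) (*P-congˡ u (+P-congʳ (-P (q *P r)) eF≋qr+r′)) ⟩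
    s *P F +P u *P (q *P r +P r′ +P -P (q *P r))
      ≈⟨ solve 4 (λ a u x r → a :+ u :* (x :+ r :- x) := a :+ u :* r) P.refl (s *P F) u (q *P r) r′ ⟩
    s *P F +P u *P r′                                ≈⟨ sF+ur′≋c ⟩
    C c                                                ∎)
    where open ≋-Reasoning

  -- The remainder `r` of `p` modulo `F` is zero or satisfies s F + u r = c′ with c′ nonzero. In the
  -- second case multiply by c q: `F` divides c q r because it divides c p q, hence it divides c′ c
  -- q.
  prime : ∀ p q → F ∣ℚ p *P q → F ∣ℚ p ⊎ F ∣ℚ q
  prime p q (c , c≢0 , F∣cpq) with pseudo-division (F-deg) p
  ... | e , m , r , e≢0 , ep≋mF+r , r-below with zero-or-degree r
  ...   | inj₁ r≋0 = inj₁ (e , e≢0 , cofactor m (begin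
    C e *P p          ≈⟨ ep≋mF+r ⟩
    m *P F +P r     ≈⟨ +P-congˡ (m *P F) r≋0 ⟩
    m *P F +P []    ≈⟨ P.+-identityʳ (m *P F) ⟩
    m *P F          ≈⟨ P.*-comm m (F) ⟩
    F *P m          ∎))
    where open ≋-Reasoning
  ...   | inj₂ (d , D) with bezout d ℕ.≤-refl (Deg-< D r-below) D
  ...     | s , u , c′ , c′≢0 , sF+ur≋c′ = inj₂ (c′ * c , m*n≢0 c′≢0 c≢0 ,
      ∣P-resp-≋ combine (∣P-+ (∣P-* (x *P s) (∣P-refl (F))) (∣P-* u F∣xr)))
    where
    open ≋-Reasoning
    x = C c *P q
    F∣xr : F ∣P x *P r
    F∣xr = ∣P-resp-≋ (begin
      C e *P (C c *P (p *P q)) +P (-P (x *P m)) *P F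
        ≈⟨ +P-congʳ ((-P (x *P m)) *P F) (solve 4 (λ e c p q → e :* (c :* (p :* q)) := c :* q :* (e :* p)) P.refl (C e) (C c) p q) ⟩
      x *P (C e *P p) +P (-P (x *P m)) *P F         ≈⟨ +P-congʳ ((-P (x *P m)) *P F) (*P-congˡ x ep≋mF+r) ⟩
      x *P (m *P F +P r) +P (-P (x *P m)) *P F
        ≈⟨ solve 4 (λ x m t r → x :* (m :* t :+ r) :+ (:- (x :* m)) :* t := x :* r) P.refl x m (F) r ⟩
      x *P r ∎) (∣P-+ (∣P-* (C e) F∣cpq) (∣P-* (-P (x *P m)) (∣P-refl (F))))
    combine : x *P s *P F +P u *P (x *P r) ≋ C (c′ * c) *P q
    combine = begin
      x *P s *P F +P u *P (x *P r)   ≈⟨ solve 5 (λ x s t u r → x :* s :* t :+ u :* (x :* r) := (s :* t :+ u :* r) :* x) P.refl x s (F) u r ⟩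
      (s *P F +P u *P r) *P x        ≈⟨ *P-congʳ x sF+ur≋c′ ⟩
      C c′ *P (C c *P q)               ≈⟨ P.*-assoc (C c′) (C c) q ⟨
      C c′ *P C c *P q                 ≈⟨ *P-congʳ q (C-* c′ c) ⟨
      C (c′ * c) *P q                  ∎

-- 2-adic descent

-- The two outer terms of the sum coincide, and what remains is a coefficient of the square of the
-- shifted sequence. This drives the parity inductions below.
conv-square-+2 : ∀ s n → conv s s (2 ℕ.+ n) ≡ s 0 * s (2 ℕ.+ n) * + 2 + conv (s ∘ suc) (s ∘ suc) n
conv-square-+2 s n rewrite conv-sucʳ (s ∘ suc) s n = lemma (s 0) (s (2 ℕ.+ n)) (conv (s ∘ suc) (s ∘ suc) n)
  where
  lemma : ∀ x y z → x * y + (z + y * x) ≡ x * y * + 2 + z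
  lemma = solve-∀

2∣conv-odd : ∀ i s → + 2 ∣ conv s s (suc (dbl i))
2∣conv-odd zero    s = divides (s 0 * s 1) (lemma (s 0) (s 1))
  where
  lemma : ∀ x y → x * y + y * x ≡ x * y * + 2
  lemma = solve-∀
2∣conv-odd (suc i) s rewrite conv-square-+2 s (suc (dbl i)) =
  ∣m∣n⇒∣m+n (divides (s 0 * s (3 ℕ.+ dbl i)) refl) (2∣conv-odd i (s ∘ suc))

-- Modulo 2 squaring is additive, so only the middle term survives in the coefficient 2i of a
-- square.
conv-even : ∀ i s → ∃ λ w → conv s s (dbl i) ≡ w * + 2 + s i * s i
conv-even zero    s = 0ℤ , sym (ℤ.+-identityˡ _)
conv-even (suc i) s with conv-even i (s ∘ suc)
... | w , e = s 0 * s (2 ℕ.+ dbl i) + w , (begin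
  conv s s (2 ℕ.+ dbl i)                                              ≡⟨ conv-square-+2 s (dbl i) ⟩
  s 0 * s (2 ℕ.+ dbl i) * + 2 + conv (s ∘ suc) (s ∘ suc) (dbl i)      ≡⟨ cong (λ x → s 0 * s (2 ℕ.+ dbl i) * + 2 + x) e ⟩
  s 0 * s (2 ℕ.+ dbl i) * + 2 + (w * + 2 + s (suc i) * s (suc i))     ≡⟨ lemma (s 0 * s (2 ℕ.+ dbl i)) w (s (suc i) * s (suc i)) ⟩
  (s 0 * s (2 ℕ.+ dbl i) + w) * + 2 + s (suc i) * s (suc i)           ∎)
  where
  open ≡-Reasoning
  lemma : ∀ x w y → x * + 2 + (w * + 2 + y) ≡ (x + w) * + 2 + y
  lemma = solve-∀

2∣xx⇒2∣x : ∀ x → + 2 ∣ x * x → + 2 ∣ x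
2∣xx⇒2∣x x d = Sum.reduce (prime-∣* prime[2] x x d)

odd-cancel : ∀ x y → ¬ (+ 2 ∣ x) → + 2 ∣ x * y → + 2 ∣ y
odd-cancel x y x-odd d = Sum.[ (λ 2∣x → ⊥-elim (x-odd 2∣x)) , (λ 2∣y → 2∣y) ] (prime-∣* prime[2] x y d)

2∣conv-even⇒ : ∀ i s → + 2 ∣ conv s s (dbl i) → + 2 ∣ s i
2∣conv-even⇒ i s d with conv-even i s
... | w , e = 2∣xx⇒2∣x (s i) (∣m+n∣m⇒∣n (subst (+ 2 ∣_) e d) (divides w refl))

⇒2∣conv-even : ∀ i s → + 2 ∣ s i → + 2 ∣ conv s s (dbl i)
⇒2∣conv-even i s d with conv-even i s
... | w , e = subst (+ 2 ∣_) (sym e) (∣m∣n⇒∣m+n (divides w refl) (∣m⇒∣m*n (s i) d))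

-- The polynomial z - b, which becomes a x^2 at z = a x^2 + b.
lin : ℤ → Poly
lin b = - b ∷ 1ℤ ∷ []

coeff-lin* : ∀ b p n → coeff (lin b *P p) (suc n) ≡ - b * coeff p (suc n) + coeff p n
coeff-lin* b p n = trans (coeff-∷* (- b) (C 1ℤ) p n)
  (cong (λ x → - b * coeff p (suc n) + x) (trans (coeff-C* 1ℤ p n) (ℤ.*-identityˡ _)))

C-2* : ∀ {x} q → x ≡ q * + 2 → C x ≋ C (+ 2) *P C q
C-2* q refl = P.trans (C-* q (+ 2)) (P.*-comm (C q) (C (+ 2)))

-- Either `a` is halved, or p = 2 p′ and a p^2 = 2 (2 a) p′^2.
halve-square-term : ∀ a p → (+ 2 ∣ a) ⊎ (+ 2 ∣ᶜ p) → ∃₂ λ a′ p′ → C a *P (p *P p) ≋ C (+ 2) *P (C a′ *P (p′ *P p′))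
halve-square-term a p (inj₁ (divides a′ e)) = a′ , p , P.trans (*P-congʳ (p *P p) (C-2* a′ e)) (P.*-assoc (C (+ 2)) (C a′) (p *P p))
halve-square-term a p (inj₂ d) with divide p d
... | p′ , 2p′≋p = a * + 2 , p′ , (begin
  C a *P (p *P p)                                       ≈⟨ *P-congˡ (C a) (P.*-cong 2p′≋p 2p′≋p) ⟨
  C a *P (C (+ 2) *P p′ *P (C (+ 2) *P p′))             ≈⟨ solve 2 (λ a p → a :* (con (+ 2) :* p :* (con (+ 2) :* p)) := con (+ 2) :* (con (+ 2) :* a :* (p :* p))) P.refl (C a) p′ ⟩
  C (+ 2) *P (C (+ 2) *P C a *P (p′ *P p′))             ≈⟨ *P-congˡ (C (+ 2)) (*P-congʳ (p′ *P p′) (C-2* a refl)) ⟨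
  C (+ 2) *P (C (a * + 2) *P (p′ *P p′))                ∎)
  where open ≋-Reasoning

halve-sum : ∀ t l {x y} x′ y′ → x ≋ t *P x′ → y ≋ t *P y′ → x +P l *P y ≋ t *P (x′ +P l *P y′)
halve-sum t l x′ y′ ex ey = P.trans (P.+-cong ex (*P-congˡ l ey))
  (solve 4 (λ t x l y → t :* x :+ l :* (t :* y) := t :* (x :+ l :* y)) P.refl t x′ l y′)

halve-summand : ∀ t l x y z y′ → t *P z ≋ x +P l *P y → y ≋ t *P y′ → t *P (z +P -P (l *P y′)) ≋ x
halve-summand t l x y z y′ ez ey = begin
  t *P (z +P -P (l *P y′))             ≈⟨ solve 4 (λ t z l y → t :* (z :- l :* y) := t :* z :- l :* (t :* y)) P.refl t z l y′ ⟩
  t *P z +P -P (l *P (t *P y′))        ≈⟨ P.+-cong ez (P.-‿cong (*P-congˡ l (P.sym ey))) ⟩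
  x +P l *P y +P -P (l *P y)           ≈⟨ solve 2 (λ x y → x :+ y :- y := x) P.refl x (l *P y) ⟩
  x                                    ∎
  where open ≋-Reasoning

module Descent (F : Poly) (F₀ : coeff F 0 ≡ 1ℤ) (F₁ : coeff F 1 ≡ + 2) (F₂ : coeff F 2 ≡ 0ℤ) (F₃ : coeff F 3 ≡ 0ℤ)
  (i : ℕ) (F-top : coeff F (suc (dbl i)) ≡ 1ℤ) (b : ℤ) where

  -- The integers `a` and `c` are free parameters, since the descent changes them along with `A` and
  -- `B`.
  record Represents (m a c : ℤ) (A B : Poly) : Set where
    constructor represents
    field identity : C m *P F ≋ C a *P (B *P B) +P lin b *P (C c *P (A *P A))

  module _ {m a c A B} (rep : Represents m a c A B) where

    open Represents rep

    private
      AA BB : Seq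
      AA = conv (coeff A) (coeff A)
      BB = conv (coeff B) (coeff B)

      coeff-sq : ∀ a p n → coeff (C a *P (p *P p)) n ≡ a * conv (coeff p) (coeff p) n
      coeff-sq a p n = trans (coeff-C* a (p *P p) n) (cong (a *_) (coeff-*P p p n))

      equation₀ : m * coeff F 0 ≡ a * BB 0 + - b * (c * AA 0)
      equation₀ = trans (sym (coeff-C* m F 0)) (trans (at identity 0) (trans (coeff-+P (C a *P (B *P B)) _ 0)
        (cong₂ _+_ (coeff-sq a B 0) (trans (coeff-*P (lin b) (C c *P (A *P A)) 0) (cong (- b *_) (coeff-sq c A 0))))))

      equation : ∀ n → m * coeff F (suc n) ≡ a * BB (suc n) + (- b * (c * AA (suc n)) + c * AA n)
      equation n = trans (sym (coeff-C* m F (suc n))) (trans (at identity (suc n)) (trans (coeff-+P (C a *P (B *P B)) _ (suc n))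
        (cong₂ _+_ (coeff-sq a B (suc n)) (trans (coeff-lin* b (C c *P (A *P A)) n)
          (cong₂ (λ x y → - b * x + y) (coeff-sq c A (suc n)) (coeff-sq c A n))))))

    -- In the odd coefficient 2i + 1 the squares contribute even numbers, except that the factor z
    -- moves c times the coefficient 2i of A^2 there, which is c times the square of the i-th
    -- coefficient of `A` modulo 2.
    A-even-at : ∀ i → ¬ (+ 2 ∣ c) → + 2 ∣ m * coeff F (suc (dbl i)) → + 2 ∣ coeff A i
    A-even-at i c-odd d = 2∣conv-even⇒ i (coeff A) (odd-cancel c _ c-odd (∣m+n∣m⇒∣n
      (∣m+n∣m⇒∣n (subst (+ 2 ∣_) (equation (dbl i)) d) (∣n⇒∣m*n a (2∣conv-odd i (coeff B))))
      (∣n⇒∣m*n (- b) (∣n⇒∣m*n c (2∣conv-odd i (coeff A))))))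

    odd-impossible : ¬ (+ 2 ∣ m) → ⊥
    odd-impossible m-odd = by-parity (+ 2 ∣? a) (+ 2 ∣? c)
      where
      to-m : ∀ {x} → x ≡ 1ℤ → + 2 ∣ m * x → + 2 ∣ m
      to-m refl d = subst (+ 2 ∣_) (ℤ.*-identityʳ m) d
      from-zero : ∀ {x} → x ≡ 0ℤ → + 2 ∣ m * x
      from-zero refl = divides 0ℤ (ℤ.*-zeroʳ m)
      A₀-even : ¬ (+ 2 ∣ c) → + 2 ∣ coeff A 0
      A₀-even c-odd = A-even-at 0 c-odd (subst (λ x → + 2 ∣ m * x) (sym F₁) (divides m refl))
      by-parity : Dec (+ 2 ∣ a) → Dec (+ 2 ∣ c) → ⊥
      by-parity (yes a-even) (no c-odd) = m-odd (to-m F₀ (subst (+ 2 ∣_) (sym equation₀)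
        (∣m∣n⇒∣m+n (∣m⇒∣m*n _ a-even) (∣n⇒∣m*n (- b) (∣n⇒∣m*n c (∣m⇒∣m*n (coeff A 0) (A₀-even c-odd)))))))
      by-parity (yes a-even) (yes c-even) = m-odd (to-m F₀ (subst (+ 2 ∣_) (sym equation₀)
        (∣m∣n⇒∣m+n (∣m⇒∣m*n _ a-even) (∣n⇒∣m*n (- b) (∣m⇒∣m*n _ c-even)))))
      -- At the odd index `suc (dbl i)` the coefficient of B^2 is even, while that of `F` is 1.
      by-parity (no a-odd) (yes c-even) = m-odd (to-m F-top (subst (+ 2 ∣_) (sym (equation (dbl i)))
        (∣m∣n⇒∣m+n (∣n⇒∣m*n a (2∣conv-odd i (coeff B))) (∣m∣n⇒∣m+n (∣n⇒∣m*n (- b) (∣m⇒∣m*n _ c-even)) (∣m⇒∣m*n _ c-even)))))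
      by-parity (no a-odd) (no c-odd) = m-odd (mod4 (A₀-even c-odd) A₁-even B₁-even)
        where
        A₁-even : + 2 ∣ coeff A 1
        A₁-even = A-even-at 1 c-odd (from-zero F₃)
        B₁-even : + 2 ∣ coeff B 1
        -- In the coefficient of z^2, which is 0 on the left, both terms coming from A^2 are even.
        B₁-even = 2∣conv-even⇒ 1 (coeff B) (odd-cancel a _ a-odd (∣m+n∣n⇒∣m
          (subst (+ 2 ∣_) (equation 1) (from-zero F₂))
          (∣m∣n⇒∣m+n (∣n⇒∣m*n (- b) (∣n⇒∣m*n c (⇒2∣conv-even 1 (coeff A) A₁-even))) (∣n⇒∣m*n c (2∣conv-odd 0 (coeff A))))))
        mod4 : + 2 ∣ coeff A 0 → + 2 ∣ coeff A 1 → + 2 ∣ coeff B 1 → + 2 ∣ m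
        -- The coefficient of z now reads 2m = 4w, and a factor 2 is cancelled.
        mod4 (divides x e₁) (divides y e₂) (divides z e₃) = divides w (ℤ.*-cancelʳ-≡ m (w * + 2) (+ 2) (trans
            (subst (λ F₁ → m * F₁ ≡ a * BB 1 + (- b * (c * AA 1) + c * AA 0)) F₁ (equation 0))
            (expand (coeff B 0) e₁ e₂ e₃)))
          where
          w = (a * coeff B 0 * z + - b * c * x * y * + 2 + c * x * x)
          expand : ∀ {A₀ A₁ B₁} B₀ → A₀ ≡ x * + 2 → A₁ ≡ y * + 2 → B₁ ≡ z * + 2 →
            a * (B₀ * B₁ + B₁ * B₀) + (- b * (c * (A₀ * A₁ + A₁ * A₀)) + c * (A₀ * A₀))
              ≡ (a * B₀ * z + - b * c * x * y * + 2 + c * x * x) * + 2 * + 2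
          expand B₀ refl refl refl = lemma a b c x y z B₀
            where
            lemma : ∀ a b c x y z B₀ →
              a * (B₀ * (z * + 2) + (z * + 2) * B₀) + (- b * (c * ((x * + 2) * (y * + 2) + (y * + 2) * (x * + 2))) + c * ((x * + 2) * (x * + 2)))
                ≡ (a * B₀ * z + - b * c * x * y * + 2 + c * x * x) * + 2 * + 2
            lemma = solve-∀

    -- With m even, `A-even-at` applies at every index, so `c` or all of `A` is even and the second
    -- term can be halved. Then 2 divides a B^2 too, and Gauss's lemma makes `a` or all of `B` even.
    even-step : ∀ m′ → m ≡ m′ * + 2 → ∃₂ λ a′ c′ → ∃₂ λ A′ B′ → Represents m′ a′ c′ A′ B′
    even-step m′ m≡2m′ = finish (halve-square-term c A c-or-A)
      where
      open ≋-Reasoning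
      2m′F : C (+ 2) *P (C m′ *P F) ≋ C a *P (B *P B) +P lin b *P (C c *P (A *P A))
      2m′F = begin
        C (+ 2) *P (C m′ *P F)   ≈⟨ P.*-assoc (C (+ 2)) (C m′) F ⟨
        C (+ 2) *P C m′ *P F     ≈⟨ *P-congʳ F (C-2* m′ m≡2m′) ⟨
        C m *P F                 ≈⟨ identity ⟩
        C a *P (B *P B) +P lin b *P (C c *P (A *P A)) ∎
      c-or-A : (+ 2 ∣ c) ⊎ (+ 2 ∣ᶜ A)
      c-or-A with + 2 ∣? c
      ... | yes c-even = inj₁ c-even
      ... | no  c-odd  = inj₂ λ i → A-even-at i c-odd (∣m⇒∣m*n _ (divides m′ m≡2m′))
      a-or-B : + 2 ∣ᶜ C a *P (B *P B) → (+ 2 ∣ a) ⊎ (+ 2 ∣ᶜ B)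
      a-or-B 2∣aBB = Sum.[ (λ 2∣Ca → inj₁ (2∣Ca 0)) , (λ 2∣BB → inj₂ (Sum.reduce (gauss prime[2] B B 2∣BB))) ]
        (gauss prime[2] (C a) (B *P B) 2∣aBB)
      finish : (∃₂ λ c′ A′ → C c *P (A *P A) ≋ C (+ 2) *P (C c′ *P (A′ *P A′))) →
        ∃₂ λ a′ c′ → ∃₂ λ A′ B′ → Represents m′ a′ c′ A′ B′
      finish (c′ , A′ , eA) with halve-square-term a B (a-or-B (∣ᶜ-resp-≋ 
          (halve-summand (C (+ 2)) (lin b) (C a *P (B *P B)) (C c *P (A *P A)) (C m′ *P F) (C c′ *P (A′ *P A′)) 2m′F eA)
          (C*-∣ᶜ (+ 2) (C m′ *P F +P -P (lin b *P (C c′ *P (A′ *P A′)))))))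
      ... | a′ , B′ , eB = a′ , c′ , A′ , B′ , represents (C*-cancel {+ 2} (λ ()) (P.trans 2m′F 
          (halve-sum (C (+ 2)) (lin b) (C a′ *P (B′ *P B′)) (C c′ *P (A′ *P A′)) eB eA)))

  -- Descent on the absolute value of `m`, bounded by `N`: it is halved until `m` is odd.
  no-representation : ∀ N {m a c A B} → ∣ m ∣ ≤ N → m ≢ 0ℤ → ¬ Represents m a c A B
  no-representation zero    ∣m∣≤0 m≢0 rep = m≢0 (ℤ.∣i∣≡0⇒i≡0 (ℕ.n≤0⇒n≡0 ∣m∣≤0))
  no-representation (suc N) {m} {a} {c} {A} {B} ∣m∣≤ m≢0 rep = by-parity (+ 2 ∣? m)
    where
    by-parity : Dec (+ 2 ∣ m) → ⊥
    by-parity (no  m-odd)                = odd-impossible rep m-odd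
    by-parity (yes (divides m′ m≡2m′)) = continue (even-step rep m′ m≡2m′)
      where
      m′≢0 : m′ ≢ 0ℤ
      m′≢0 refl = m≢0 m≡2m′
      ∣m′∣≤N : ∣ m′ ∣ ≤ N
      ∣m′∣≤N = ℕ.≤-pred (ℕ.≤-trans (ℕ.m<m*n ∣ m′ ∣ 2 {{ℕ.≢-nonZero (λ e → m′≢0 (ℤ.∣i∣≡0⇒i≡0 e))}} (s≤s (s≤s z≤n)))
        (subst (_≤ suc N) (trans (cong ∣_∣ m≡2m′) (ℤ.abs-* m′ (+ 2))) ∣m∣≤))
      continue : (∃₂ λ a′ c′ → ∃₂ λ A′ B′ → Represents m′ a′ c′ A′ B′) → ⊥
      continue (_ , _ , _ , _ , rep′) = no-representation N ∣m′∣≤N m′≢0 rep′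

-- Substituting a x² + b

module Substitution (u : Poly) where

  -- `_∘P_` recurses on the list, so lists of zeros come first; they are what is left over when
  -- equal polynomials have lists of different lengths.
  ∘-zero : ∀ p → p ≋ [] → p ∘P u ≋ []
  ∘-zero []      _ = P.refl
  ∘-zero (c ∷ p) e = begin
    C c +P u *P (p ∘P u)   ≈⟨ P.+-cong (mk≋ λ { zero → at e 0 ; (suc n) → refl }) (*P-congˡ u (∘-zero p (mk≋ (at e ∘ suc)))) ⟩
    [] +P u *P []          ≈⟨ P.zeroʳ u ⟩
    []                     ∎
    where open ≋-Reasoning

  ∘-cong : ∀ p q → p ≋ q → p ∘P u ≋ q ∘P u
  ∘-cong []      q       e = P.sym (∘-zero q (P.sym e))
  ∘-cong (c ∷ p) []      e = ∘-zero (c ∷ p) e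
  ∘-cong (c ∷ p) (d ∷ q) e = P.+-cong {C c} {C d} (mk≋ λ { zero → at e 0 ; (suc n) → refl }) (*P-congˡ u (∘-cong p q (mk≋ (at e ∘ suc))))

  ∘-+ : ∀ p q → (p +P q) ∘P u ≋ p ∘P u +P q ∘P u
  ∘-+ []      q       = P.refl
  ∘-+ (c ∷ p) []      = P.sym (P.+-identityʳ _)
  ∘-+ (c ∷ p) (d ∷ q) = P.trans (+P-congˡ (C (c + d)) (*P-congˡ u (∘-+ p q)))
    (solve 5 (λ c d u p q → c :+ d :+ u :* (p :+ q) := c :+ u :* p :+ (d :+ u :* q)) P.refl (C c) (C d) u (p ∘P u) (q ∘P u))

  ∘-C : ∀ c → C c ∘P u ≋ C c
  ∘-C c = P.trans (+P-congˡ (C c) (P.zeroʳ u)) (P.+-identityʳ (C c))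

  ∘-scale : ∀ c p → map (c *_) p ∘P u ≋ C c *P (p ∘P u)
  ∘-scale c []      = P.sym (P.zeroʳ (C c))
  ∘-scale c (d ∷ p) = P.trans (P.+-cong (C-* c d) (*P-congˡ u (∘-scale c p)))
    (solve 4 (λ c d u p → c :* d :+ u :* (c :* p) := c :* (d :+ u :* p)) P.refl (C c) (C d) u (p ∘P u))

  ∘-* : ∀ p q → (p *P q) ∘P u ≋ (p ∘P u) *P (q ∘P u)
  ∘-* []      q = P.refl
  ∘-* (c ∷ p) q = begin
    (map (c *_) q +P (0ℤ ∷ (p *P q))) ∘P u                              ≈⟨ ∘-+ (map (c *_) q) (0ℤ ∷ (p *P q)) ⟩
    map (c *_) q ∘P u +P (C 0ℤ +P u *P ((p *P q) ∘P u))                 ≈⟨ P.+-cong (∘-scale c q) (+P-congˡ (C 0ℤ) (*P-congˡ u (∘-* p q))) ⟩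
    C c *P (q ∘P u) +P (C 0ℤ +P u *P ((p ∘P u) *P (q ∘P u)))            ≈⟨ solve 4 (λ c u p q → c :* q :+ (con 0ℤ :+ u :* (p :* q)) := (c :+ u :* p) :* q) P.refl (C c) u (p ∘P u) (q ∘P u) ⟩
    (C c +P u *P (p ∘P u)) *P (q ∘P u)                                  ∎
    where open ≋-Reasoning

  ∘-neg : ∀ p → (-P p) ∘P u ≋ -P (p ∘P u)
  ∘-neg []      = P.refl
  ∘-neg (c ∷ p) = P.trans (+P-congˡ (C (- c)) (*P-congˡ u (∘-neg p)))
    (solve 3 (λ c u p → :- c :+ u :* (:- p) := :- (c :+ u :* p)) P.refl (C c) u (p ∘P u))

  ∘-deg : Deg u 2 → ∀ {p d} → Deg p d → Deg (p ∘P u) (dbl d)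
  ∘-deg U {[]} D = ⊥-elim (¬Deg[] P.refl D)
  ∘-deg U {c ∷ p} {zero} (deg c≢0 P) = Deg-cong (P.sym (begin
    C c +P u *P (p ∘P u)   ≈⟨ +P-congˡ (C c) (*P-congˡ u (∘-zero p (mk≋ λ n → P (suc n) (s≤s z≤n)))) ⟩
    C c +P u *P []         ≈⟨ +P-congˡ (C c) (P.zeroʳ u) ⟩
    C c +P []              ≈⟨ P.+-identityʳ (C c) ⟩
    C c                    ∎)) (C-deg c≢0)
    where open ≋-Reasoning
  ∘-deg U {c ∷ p} {suc d} (deg p≢0 P) = C+-deg (Deg-* U (∘-deg U {p} {d} (deg p≢0 λ i d<i → P (suc i) (s≤s d<i))))
    where
    C+-deg : ∀ {q e} → Deg q (suc e) → Deg (C c +P q) (suc e)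
    C+-deg {q} {e} (deg q≢0 Q) = deg (λ z → q≢0 (trans (sym (same e)) z)) λ { (suc i) le → trans (same i) (Q (suc i) le) }
      where
      same : ∀ i → coeff (C c +P q) (suc i) ≡ coeff q (suc i)
      same i = trans (coeff-+P (C c) q (suc i)) (ℤ.+-identityˡ _)

dbl≢1+dbl : ∀ m n → dbl m ≢ suc (dbl n)
dbl≢1+dbl (suc m) (suc n) e = dbl≢1+dbl m n (ℕ.suc-injective (ℕ.suc-injective e))

∷≋C+X* : ∀ c p → c ∷ p ≋ C c +P X *P p
∷≋C+X* c p = P.trans (mk≋ λ { zero → sym (ℤ.+-identityʳ c) ; (suc n) → refl }) (+P-congˡ (C c) (P.sym (X*shift 0 p)))

-- Even and odd parts over a x^2 + b

module Quadratic (a b : ℤ) (a≢0 : a ≢ 0ℤ) where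

  u : Poly
  u = quadAB a b

  open Substitution u public

  u-deg : Deg u 2
  u-deg = deg a≢0 λ { 0 () ; 1 (s≤s ()) ; 2 (s≤s (s≤s ())) ; (suc (suc (suc i))) _ → refl }

  l : Poly
  l = lin b

  l∘u : l ∘P u ≋ C a *P X *P X
  l∘u = begin
    C (- b) +P u *P (C 1ℤ +P u *P [])         ≈⟨ +P-congˡ (C (- b)) (*P-congˡ u (+P-congˡ (C 1ℤ) (P.zeroʳ u))) ⟩
    C (- b) +P u *P C 1ℤ                      ≈⟨ +P-congˡ (C (- b)) (P.*-identityʳ u) ⟩
    (- b + b) ∷ 0ℤ ∷ a ∷ []                   ≡⟨ cong (_∷ 0ℤ ∷ a ∷ []) (ℤ.+-inverseˡ b) ⟩
    shift 2 (C a)                             ≈⟨ X*shift 1 (C a) ⟨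
    X *P shift 1 (C a)                        ≈⟨ *P-congˡ X (X*shift 0 (C a)) ⟨
    X *P (X *P C a)                           ≈⟨ solve 2 (λ x a → x :* (x :* a) := a :* x :* x) P.refl X (C a) ⟩
    C a *P X *P X                             ∎
    where open ≋-Reasoning

  -- The first summand has even degree and the second odd degree unless they vanish, so they cannot
  -- cancel.
  even-odd-unique : ∀ p q → p ∘P u +P X *P (q ∘P u) ≋ [] → p ≋ [] × q ≋ []
  even-odd-unique p q e = by-degree (zero-or-degree p) (zero-or-degree q)
    where
    open ≋-Reasoning
    X-deg : Deg X 1
    X-deg = ∷-deg (C-deg λ ())
    odd-part : ∀ {d} → Deg q d → Deg (X *P (q ∘P u)) (suc (dbl d))
    odd-part D = Deg-* X-deg (∘-deg u-deg D)
    by-degree : p ≋ [] ⊎ ∃ (Deg p) → q ≋ [] ⊎ ∃ (Deg q) → p ≋ [] × q ≋ []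
    by-degree (inj₁ p≋0) (inj₁ q≋0) = p≋0 , q≋0
    by-degree (inj₁ p≋0) (inj₂ (_ , D)) =
      ⊥-elim (¬Deg[] (P.trans (P.sym (+P-congʳ (X *P (q ∘P u)) (∘-zero p p≋0))) e) (odd-part D))
    by-degree (inj₂ (_ , D)) (inj₁ q≋0) = ⊥-elim (¬Deg[] (begin
      p ∘P u                       ≈⟨ P.+-identityʳ (p ∘P u) ⟨
      p ∘P u +P []                 ≈⟨ +P-congˡ (p ∘P u) (P.trans (*P-congˡ X (∘-zero q q≋0)) (P.zeroʳ X)) ⟨
      p ∘P u +P X *P (q ∘P u)      ≈⟨ e ⟩
      []                           ∎) (∘-deg u-deg D))
    by-degree (inj₂ (d , D)) (inj₂ (d′ , D′)) = ⊥-elim (dbl≢1+dbl d d′ (Deg-unique (∘-deg u-deg D)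
      (Deg-cong (begin
        C -1ℤ *P y         ≈⟨ solve 2 (λ x y → con -1ℤ :* y := x :- (x :+ y)) P.refl x y ⟩
        x +P -P (x +P y)   ≈⟨ +P-congˡ x (P.-‿cong e) ⟩
        x +P []            ≈⟨ P.+-identityʳ x ⟩
        x                  ∎) (Deg-* {C -1ℤ} (C-deg λ ()) (odd-part D′)))))
      where
      x = p ∘P u
      y = X *P (q ∘P u)

  -- The even and odd parts of `g` as polynomials in `u`. Since x^2 = (u - b) / a, powers of `a`
  -- occur in denominators; `scalar` clears them.
  record Split (g : Poly) : Set where
    field
      scalar   : ℤ
      A B      : Poly
      scalar≢0 : scalar ≢ 0ℤ
      split    : C scalar *P g ≋ B ∘P u +P X *P (A ∘P u)

  -- Multiplication by x exchanges the two parts, and a x^2 = u - b turns the old odd part into a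
  -- polynomial in `u`.
  split-∷ : ∀ {g} c → Split g → Split (c ∷ g)
  split-∷ {g} c s = record
    { scalar = a * scalar ; A = C a *P B ; B = C (a * scalar * c) +P l *P A ; scalar≢0 = m*n≢0 a≢0 scalar≢0
    ; split = begin
        C (a * scalar) *P (c ∷ g)                                  ≈⟨ *P-congˡ (C (a * scalar)) (∷≋C+X* c g) ⟩
        C (a * scalar) *P (C c +P X *P g)                          ≈⟨ P.distribˡ (C (a * scalar)) (C c) (X *P g) ⟩
        C (a * scalar) *P C c +P C (a * scalar) *P (X *P g)        ≈⟨ P.+-cong (P.sym (C-* (a * scalar) c)) (*P-congʳ (X *P g) (C-* a scalar)) ⟩
        C k +P C a *P C scalar *P (X *P g)                         ≈⟨ solve 5 (λ k a s x g → k :+ a :* s :* (x :* g) := k :+ a :* x :* (s :* g)) P.refl (C k) (C a) (C scalar) X g ⟩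
        C k +P C a *P X *P (C scalar *P g)                         ≈⟨ +P-congˡ (C k) (*P-congˡ (C a *P X) split) ⟩
        C k +P C a *P X *P (β +P X *P α)                           ≈⟨ solve 5 (λ k a x α β → k :+ a :* x :* (β :+ x :* α) := k :+ a :* x :* x :* α :+ x :* (a :* β)) P.refl (C k) (C a) X α β ⟩
        C k +P C a *P X *P X *P α +P X *P (C a *P β)               ≈⟨ P.+-cong (P.+-cong (P.sym (∘-C k)) (P.trans (*P-congʳ α (P.sym l∘u)) (P.sym (∘-* l A))))
                                                                        (*P-congˡ X (P.trans (*P-congʳ β (P.sym (∘-C a))) (P.sym (∘-* (C a) B)))) ⟩
        C k ∘P u +P (l *P A) ∘P u +P X *P ((C a *P B) ∘P u)        ≈⟨ +P-congʳ (X *P ((C a *P B) ∘P u)) (∘-+ (C k) (l *P A)) ⟨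
        (C k +P l *P A) ∘P u +P X *P ((C a *P B) ∘P u)             ∎ }
    where
    open ≋-Reasoning
    open Split s
    k = a * scalar * c
    α = A ∘P u
    β = B ∘P u

  split-poly : ∀ g → Split g
  split-poly []      = record { scalar = 1ℤ ; A = [] ; B = [] ; scalar≢0 = λ ()
    ; split = P.trans (P.zeroʳ (C 1ℤ)) (P.sym (P.zeroʳ X)) }
  split-poly (c ∷ g) = split-∷ c (split-poly g)

  norm : ∀ {g} → Split g → Poly
  norm s = C a *P (B *P B) +P -P (l *P (A *P A))
    where open Split s

  -- norm(s) ∘ u = a · (scalar · g(x)) · (scalar · g(−x)).
  norm-nonunit : ∀ {g} (s : Split g) → NonConstant g → ∀ w {c} → c ≢ 0ℤ → ¬ (w *P norm s ≋ C c)
  norm-nonunit {g} s G w {c} c≢0 e = ∤const {g} c≢0 G (begin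
    -- The cofactor of `g` is made from the conjugate β - x α, so that the whole product is w times
    -- the norm, taken at `u`.
    g *P (C scalar *P (C a *P ((w ∘P u) *P (β +P -P (X *P α)))))
      ≈⟨ solve 5 (λ g s a w y → g :* (s :* (a :* (w :* y))) := a :* w :* (s :* g) :* y) P.refl g (C scalar) (C a) (w ∘P u) (β +P -P (X *P α)) ⟩
    C a *P (w ∘P u) *P (C scalar *P g) *P (β +P -P (X *P α))
      ≈⟨ *P-congʳ (β +P -P (X *P α)) (*P-congˡ (C a *P (w ∘P u)) split) ⟩
    C a *P (w ∘P u) *P (β +P X *P α) *P (β +P -P (X *P α))
      ≈⟨ solve 5 (λ a w x α β → a :* w :* (β :+ x :* α) :* (β :- x :* α) := w :* (a :* (β :* β) :- a :* x :* x :* (α :* α))) P.refl (C a) (w ∘P u) X α β ⟩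
    (w ∘P u) *P (C a *P (β *P β) +P -P (C a *P X *P X *P (α *P α)))
      ≈⟨ *P-congˡ (w ∘P u) norm∘u ⟨
    (w ∘P u) *P (norm s ∘P u)      ≈⟨ ∘-* w (norm s) ⟨
    (w *P norm s) ∘P u             ≈⟨ ∘-cong (w *P norm s) (C c) e ⟩
    C c ∘P u                       ≈⟨ ∘-C c ⟩
    C c                            ∎)
    where
    open ≋-Reasoning
    open Split s
    α = A ∘P u
    β = B ∘P u
    norm∘u : norm s ∘P u ≋ C a *P (β *P β) +P -P (C a *P X *P X *P (α *P α))
    norm∘u = begin
      norm s ∘P u                                                        ≈⟨ ∘-+ (C a *P (B *P B)) (-P (l *P (A *P A))) ⟩
      (C a *P (B *P B)) ∘P u +P (-P (l *P (A *P A))) ∘P u                ≈⟨ P.+-cong (∘-* (C a) (B *P B)) (P.trans (∘-neg (l *P (A *P A))) (P.-‿cong (∘-* l (A *P A)))) ⟩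
      (C a ∘P u) *P ((B *P B) ∘P u) +P -P ((l ∘P u) *P ((A *P A) ∘P u))  ≈⟨ P.+-cong (P.*-cong (∘-C a) (∘-* B B)) (P.-‿cong (P.*-cong l∘u (∘-* A A))) ⟩
      C a *P (β *P β) +P -P (C a *P X *P X *P (α *P α))                  ∎

-- Factors of F² and the norms of a factorisation

module _ (F : Poly) (n : ℕ) (F-deg : Deg F n)
  (F-irreducible : ∀ g h → NonConstant g → NonConstant h → ¬ (g *P h ≋ F)) where

  open IrreducibleIsPrime F n F-deg F-irreducible

  -- Units of ℚ[x], with denominators cleared.
  Unit : Poly → Set
  Unit p = ∃₂ λ w c → c ≢ 0ℤ × w *P p ≋ C c

  -- Associates of `F` in ℚ[x]; `c` is nonzero too, because μ F is not the zero polynomial.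
  Associate : Poly → Set
  Associate p = ∃₂ λ c μ → μ ≢ 0ℤ × C c *P p ≋ C μ *P F

  cancel-F : ∀ p q k c m → p *P q ≋ C k *P (F *P F) → C c *P p ≋ F *P m → m *P q ≋ C (c * k) *P F
  cancel-F p q k c m e e′ = *P-cancelˡ F-deg (begin
    F *P (m *P q)               ≈⟨ P.*-assoc F m q ⟨
    F *P m *P q                 ≈⟨ *P-congʳ q e′ ⟨
    C c *P p *P q               ≈⟨ P.*-assoc (C c) p q ⟩
    C c *P (p *P q)             ≈⟨ *P-congˡ (C c) e ⟩
    C c *P (C k *P (F *P F))    ≈⟨ solve 3 (λ c k f → c :* (k :* (f :* f)) := f :* (c :* k :* f)) P.refl (C c) (C k) F ⟩
    F *P (C c *P C k *P F)      ≈⟨ *P-congˡ F (*P-congʳ F (C-* c k)) ⟨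
    F *P (C (c * k) *P F)       ∎)
    where open ≋-Reasoning

  cancel-F′ : ∀ m q k c r → m *P q ≋ C k *P F → C c *P m ≋ F *P r → r *P q ≋ C (c * k)
  cancel-F′ m q k c r e e′ = *P-cancelˡ F-deg (begin
    F *P (r *P q)               ≈⟨ P.*-assoc F r q ⟨
    F *P r *P q                 ≈⟨ *P-congʳ q e′ ⟨
    C c *P m *P q               ≈⟨ P.*-assoc (C c) m q ⟩
    C c *P (m *P q)             ≈⟨ *P-congˡ (C c) e ⟩
    C c *P (C k *P F)           ≈⟨ solve 3 (λ c k f → c :* (k :* f) := f :* (c :* k)) P.refl (C c) (C k) F ⟩
    F *P (C c *P C k)           ≈⟨ *P-congˡ F (C-* c k) ⟨
    F *P C (c * k)              ∎)
    where open ≋-Reasoning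

  -- Cancelling one `F` leaves m q equal to a constant times `F`, so `F` divides `m` or `q`. If it
  -- divides `m`, cancelling again shows that `q` divides a nonzero constant.
  divisor-of-F² : ∀ p q {k} → k ≢ 0ℤ → p *P q ≋ C k *P (F *P F) → F ∣ℚ p → Unit q ⊎ F ∣ℚ q
  divisor-of-F² p q {k} k≢0 e (c , c≢0 , cofactor m cp≋Fm) = Sum.map₁ unit
      (prime m q (1ℤ , (λ ()) , cofactor (C (c * k)) (P.trans (P.*-identityˡ (m *P q)) (P.trans mq≋ckF (P.*-comm (C (c * k)) F)))))
    where
    mq≋ckF : m *P q ≋ C (c * k) *P F
    mq≋ckF = cancel-F p q k c m e cp≋Fm
    unit : F ∣ℚ m → Unit q
    unit (d , d≢0 , cofactor r dm≋Fr) = r , d * (c * k) , m*n≢0 d≢0 (m*n≢0 c≢0 k≢0) , cancel-F′ m q (c * k) d r mq≋ckF dm≋Fr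

  -- Cancelling `F` twice makes the product of the two cofactors a nonzero constant, so the cofactor
  -- of `p` is constant.
  both-divisible : ∀ p q {k} → k ≢ 0ℤ → p *P q ≋ C k *P (F *P F) → F ∣ℚ p → F ∣ℚ q → Associate p
  both-divisible p q {k} k≢0 e (c , c≢0 , cofactor m cp≋Fm) (d , d≢0 , cofactor r dq≋Fr) = associate (Deg0⇒const (proj₂ (const-factors {r} {m}
      (m*n≢0 d≢0 (m*n≢0 c≢0 k≢0)) (cancel-F′ q m (c * k) d r (P.trans (P.*-comm q m) (cancel-F p q k c m e cp≋Fm)) dq≋Fr))))
    where
    associate : (∃ λ μ → μ ≢ 0ℤ × m ≋ C μ) → Associate p
    associate (μ , μ≢0 , m≋μ) = c , μ , μ≢0 , P.trans cp≋Fm (P.trans (*P-congˡ F m≋μ) (P.*-comm F (C μ)))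

  factors-of-F² : ∀ p q {k} → k ≢ 0ℤ → p *P q ≋ C k *P (F *P F) → Unit p ⊎ Unit q ⊎ Associate p
  factors-of-F² p q {k} k≢0 e = Sum.[ from-p , from-q ] (prime p q (1ℤ , (λ ()) , cofactor (C k *P F) (P.trans (P.*-identityˡ (p *P q))
      (P.trans e (solve 2 (λ k f → k :* (f :* f) := f :* (k :* f)) P.refl (C k) F)))))
    where
    from-p : F ∣ℚ p → Unit p ⊎ Unit q ⊎ Associate p
    from-p F∣p = inj₂ (Sum.map₂ (both-divisible p q k≢0 e F∣p) (divisor-of-F² p q k≢0 e F∣p))
    from-q : F ∣ℚ q → Unit p ⊎ Unit q ⊎ Associate p
    from-q F∣q = Sum.map₂ (λ F∣p → inj₂ (both-divisible p q k≢0 e F∣p F∣q)) (divisor-of-F² q p k≢0 (P.trans (P.*-comm q p) e) F∣q)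

  module _ (a b : ℤ) (a≢0 : a ≢ 0ℤ)
    (no-representation : ∀ m a′ c A B → m ≢ 0ℤ → ¬ (C m *P F ≋ C a′ *P (B *P B) +P lin b *P (C c *P (A *P A)))) where

    open Quadratic a b a≢0

    -- Comparing even and odd parts of the product of the two splittings.
    product-of-norms : ∀ {g h} (s : Split g) (t : Split h) → g *P h ≋ F ∘P u →
      ∃ λ k → k ≢ 0ℤ × norm s *P norm t ≋ C k *P (F *P F)
    product-of-norms {g} {h} s t gh≋F∘u = k * k , m*n≢0 k≢0 k≢0 , (begin
        norm s *P norm t
          -- Brahmagupta's identity: the norm is multiplicative up to the factor a, so the product
          -- is even^2 - l a odd^2.
          ≈⟨ solve 6 (λ a l A B A′ B′ → (a :* (B :* B) :- l :* (A :* A)) :* (a :* (B′ :* B′) :- l :* (A′ :* A′))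
               := (a :* (B :* B′) :+ l :* (A :* A′)) :* (a :* (B :* B′) :+ l :* (A :* A′)) :- l :* (A :* B′ :+ A′ :* B) :* (a :* (A :* B′ :+ A′ :* B)))
               P.refl (C a) l A B A′ B′ ⟩
        even *P even +P -P (l *P odd *P (C a *P odd))    ≈⟨ P.+-cong (P.*-cong even≋ even≋) (P.-‿cong (*P-congˡ (l *P odd) odd≋0)) ⟩
        C k *P F *P (C k *P F) +P -P (l *P odd *P [])    ≈⟨ +P-congˡ (C k *P F *P (C k *P F)) (P.-‿cong (P.zeroʳ (l *P odd))) ⟩
        C k *P F *P (C k *P F) +P []                     ≈⟨ P.+-identityʳ (C k *P F *P (C k *P F)) ⟩
        C k *P F *P (C k *P F)                           ≈⟨ solve 2 (λ k f → k :* f :* (k :* f) := k :* k :* (f :* f)) P.refl (C k) F ⟩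
        C k *P C k *P (F *P F)                           ≈⟨ *P-congʳ (F *P F) (C-* k k) ⟨
        C (k * k) *P (F *P F)                            ∎)
      where
      open ≋-Reasoning
      open Split s
      open Split t using () renaming (scalar to scalar′; A to A′; B to B′; scalar≢0 to scalar′≢0; split to split′)
      -- The extra factor `a` turns the x^2 in the product of the odd parts into a x^2, the value of
      -- `l` at `u`.
      k = a * (scalar * scalar′)
      k≢0 : k ≢ 0ℤ
      k≢0 = m*n≢0 a≢0 (m*n≢0 scalar≢0 scalar′≢0)
      even = C a *P (B *P B′) +P l *P (A *P A′)
      odd = A *P B′ +P A′ *P B
      α = A ∘P u
      β = B ∘P u
      α′ = A′ ∘P u
      β′ = B′ ∘P u
      even∘u : even ∘P u ≋ C a *P (β *P β′) +P C a *P X *P X *P (α *P α′)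
      even∘u = begin
        even ∘P u                                                            ≈⟨ ∘-+ (C a *P (B *P B′)) (l *P (A *P A′)) ⟩
        (C a *P (B *P B′)) ∘P u +P (l *P (A *P A′)) ∘P u                     ≈⟨ P.+-cong (∘-* (C a) (B *P B′)) (∘-* l (A *P A′)) ⟩
        (C a ∘P u) *P ((B *P B′) ∘P u) +P (l ∘P u) *P ((A *P A′) ∘P u)       ≈⟨ P.+-cong (P.*-cong (∘-C a) (∘-* B B′)) (P.*-cong l∘u (∘-* A A′)) ⟩
        C a *P (β *P β′) +P C a *P X *P X *P (α *P α′)                       ∎
      odd∘u : (C a *P odd) ∘P u ≋ C a *P (α *P β′ +P α′ *P β)
      odd∘u = P.trans (∘-* (C a) odd) (P.*-cong (∘-C a) (P.trans (∘-+ (A *P B′) (A′ *P B)) (P.+-cong (∘-* A B′) (∘-* A′ B))))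
      kF∘u : (C k *P F) ∘P u ≋ C a *P ((β +P X *P α) *P (β′ +P X *P α′))
      kF∘u = begin
        (C k *P F) ∘P u                                          ≈⟨ ∘-* (C k) F ⟩
        (C k ∘P u) *P (F ∘P u)                                   ≈⟨ P.*-cong (∘-C k) (P.sym gh≋F∘u) ⟩
        C k *P (g *P h)                                          ≈⟨ *P-congʳ (g *P h) (P.trans (C-* a (scalar * scalar′)) (*P-congˡ (C a) (C-* scalar scalar′))) ⟩
        C a *P (C scalar *P C scalar′) *P (g *P h)
          ≈⟨ solve 5 (λ a s s′ g h → a :* (s :* s′) :* (g :* h) := a :* (s :* g :* (s′ :* h))) P.refl (C a) (C scalar) (C scalar′) g h ⟩
        C a *P (C scalar *P g *P (C scalar′ *P h))               ≈⟨ *P-congˡ (C a) (P.*-cong split split′) ⟩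
        C a *P ((β +P X *P α) *P (β′ +P X *P α′))                ∎
      vanish : (even +P -P (C k *P F)) ∘P u +P X *P ((C a *P odd) ∘P u) ≋ []
      vanish = begin
        (even +P -P (C k *P F)) ∘P u +P X *P ((C a *P odd) ∘P u)
          ≈⟨ P.+-cong (P.trans (∘-+ even (-P (C k *P F))) (P.+-cong even∘u (P.trans (∘-neg (C k *P F)) (P.-‿cong kF∘u)))) (*P-congˡ X odd∘u) ⟩
        C a *P (β *P β′) +P C a *P X *P X *P (α *P α′) +P -P (C a *P ((β +P X *P α) *P (β′ +P X *P α′))) +P X *P (C a *P (α *P β′ +P α′ *P β))
          ≈⟨ solve 6 (λ a x α β α′ β′ → a :* (β :* β′) :+ a :* x :* x :* (α :* α′) :- a :* ((β :+ x :* α) :* (β′ :+ x :* α′)) :+ x :* (a :* (α :* β′ :+ α′ :* β)) := con 0ℤ)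
               P.refl (C a) X α β α′ β′ ⟩
        C 0ℤ     ≈⟨ mk≋ (λ { zero → refl ; (suc n) → refl }) ⟩
        []       ∎
      unique = even-odd-unique (even +P -P (C k *P F)) (C a *P odd) vanish
      odd≋0 : C a *P odd ≋ []
      odd≋0 = proj₂ unique
      even≋ : even ≋ C k *P F
      even≋ = begin
        even                                       ≈⟨ solve 2 (λ x y → x := (x :- y) :+ y) P.refl even (C k *P F) ⟩
        even +P -P (C k *P F) +P C k *P F          ≈⟨ +P-congʳ (C k *P F) (proj₁ unique) ⟩
        C k *P F                                   ∎

    -- An association with `F` is a representation with coefficients c a and -c.
    norm-not-associate : ∀ {g} (s : Split g) → ¬ Associate (norm s)
    norm-not-associate s (c , μ , μ≢0 , e) = no-representation μ (c * a) (- c) A B μ≢0 (begin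
      C μ *P F                                                ≈⟨ e ⟨
      C c *P (C a *P (B *P B) +P -P (l *P (A *P A)))
        ≈⟨ solve 5 (λ c a l x y → c :* (a :* x :- l :* y) := c :* a :* x :+ l :* (:- c :* y)) P.refl (C c) (C a) l (B *P B) (A *P A) ⟩
      C c *P C a *P (B *P B) +P l *P (C (- c) *P (A *P A))    ≈⟨ +P-congʳ (l *P (C (- c) *P (A *P A))) (*P-congʳ (B *P B) (C-* c a)) ⟨
      C (c * a) *P (B *P B) +P l *P (C (- c) *P (A *P A))     ∎)
      where
      open ≋-Reasoning
      open Split s

    composition-irreducible : ∀ g h → NonConstant g → NonConstant h → ¬ (g *P h ≋ F ∘P u)
    composition-irreducible g h G H e = refute (product-of-norms s t e)
      where
      s = split-poly g
      t = split-poly h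
      refute : ¬ (∃ λ k → k ≢ 0ℤ × norm s *P norm t ≋ C k *P (F *P F))
      refute (k , k≢0 , e) = Sum.[ (λ { (w , c , c≢0 , e′) → norm-nonunit s G w c≢0 e′ }) ,
        Sum.[ (λ { (w , c , c≢0 , e′) → norm-nonunit t H w c≢0 e′ }) , norm-not-associate s ] ]
        (factors-of-F² (norm s) (norm t) k≢0 e)

-- The family f k

f≡T : ∀ j → f (2 ℕ.+ j) ≡ T j
f≡T j = cong (λ m → 1ℤ ∷ + 2 ∷ shift (suc m) (C 1ℤ)) (exponent j)
  where
  -- The left side is what `2 ℕ.* k ℕ.∸ 1` reduces to for k = 2 + j, less one `suc`.
  exponent : ∀ j → j ℕ.+ suc (suc (j ℕ.+ 0)) ≡ 2 ℕ.+ dbl j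
  exponent zero    = refl
  exponent (suc j) = cong suc (trans (ℕ.+-suc j _) (cong suc (exponent j)))

theorem1p5 : (k : ℕ) → 2 ≤ k → (a b : ℤ) → a ≢ 0ℤ →
    IrreducibleOverℤ (f k ∘P quadAB a b)
theorem1p5 (suc (suc j)) (s≤s (s≤s z≤n)) a b a≢0 = subst (λ F → IrreducibleOverℤ (F ∘P quadAB a b)) (sym (f≡T j))
  ( Deg⇒NonConstant (Quadratic.∘-deg a b a≢0 (Quadratic.u-deg a b a≢0) (T-deg j))
  , λ g h G H e → composition-irreducible (T j) (5 ℕ.+ dbl j) (T-deg j) (T-irreducible j) a b a≢0
      (λ m a′ c A B m≢0 e′ → no-representation ∣ m ∣ {m} {a′} {c} {A} {B} ℕ.≤-refl m≢0 (represents e′))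
      g h G H (mk≋ e) )
  -- The coefficients 1, 2, 0, 0 hold by computation, since the degree `5 + dbl j` keeps the leading
  -- term above x^3.
  where open Descent (T j) refl refl refl refl (2 ℕ.+ j) (T-top j) b
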